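{- Let $A\subset\mathbb{R}$ be a finite set with $|A|\ge 2$. Then there exists a subset $A'\subset A$ with $|A'|\ge |A|/2$ such that for all $a\in A'$, \[ |(A+A)(A+a)|\gg \frac{|A|^{5/3}}{(\log|A|)^{1/3}}. \]
   Context: $(A+A)(A+a)=\{(b+c)(d+a): b,c,d\in A\}$. $X\gg Y$ means $X\ge cY$ for some absolute constant $c>0$. Logarithms are to base 2. -}

module Defs where

open import Level using (0ℓ)
open import Data.Nat as ℕ using (ℕ)
open import Data.Fin using (Fin)
open import Data.Fin.Subset using (Subset; _∈_; ∣_∣)
open import Data.Product using (Σ; ∃; _×_; _,_)
open import Relation.Binary.PropositionalEquality using (_≡_)
open import Relation.Binary.Definitions using (Decidable)
open import Relation.Nullary using (¬_)
open import Algebra.Bundles using (CommutativeRing)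
open import Relation.Binary.Structures using (IsStrictTotalOrder)

-- Axioms of the real numbers: a (Dedekind-)complete ordered field.
-- Up to isomorphism ℝ is the unique model, so quantifying over all
-- models is the same as speaking about ℝ.  Decidability of ≈ and <
-- holds classically in ℝ and is included as an axiom.
record RealNumbers : Set₁ where
  field
    commRing : CommutativeRing 0ℓ 0ℓ
  open CommutativeRing commRing public
  field
    0≉1     : ¬ (0# ≈ 1#)
    inverse : ∀ x → ¬ (x ≈ 0#) → Σ Carrier λ y → (x * y) ≈ 1#
    _<_               : Carrier → Carrier → Set
    <-isStrictTotalOrder : IsStrictTotalOrder _≈_ _<_
    +-mono-<          : ∀ {x y} z → x < y → (x + z) < (y + z)
    *-pos             : ∀ {x y} → 0# < x → 0# < y → 0# < (x * y)
    _≟_ : Decidable _≈_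
  _≤_ : Carrier → Carrier → Set
  x ≤ y = ¬ (y < x)
  field
    sup : (P : Carrier → Set) → Σ Carrier P →
          Σ Carrier (λ b → ∀ x → P x → x ≤ b) →
          Σ Carrier λ s → (∀ x → P x → x ≤ s) ×
                          (∀ b → (∀ x → P x → x ≤ b) → s ≤ b)

module _ (ℝ : RealNumbers) where
  open RealNumbers ℝ

  IsFiniteSet : (n : ℕ) → (Fin n → Carrier) → Set
  IsFiniteSet n A = ∀ i j → A i ≈ A j → i ≡ j

  prodElt : ∀ {n} → (Fin n → Carrier) → Carrier → Fin n × Fin n × Fin n → Carrier
  prodElt A a (b , c , d) = (A b + A c) * (A d + a)

  -- "(A+A)(A+a) has at least m elements": m index triples giving
  -- pairwise distinct elements of (A+A)(A+a).
  AtLeast : ∀ {n} → ℕ → (Fin n → Carrier) → Carrier → Set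
  AtLeast {n} m A a =
    Σ (Fin m → Fin n × Fin n × Fin n) λ f →
      ∀ i j → prodElt A a (f i) ≈ prodElt A a (f j) → i ≡ j

{-# OPTIONS --safe #-}
module Submission where

open import Defs
import Algebra.Properties.Group
import Algebra.Properties.Ring
import Algebra.Solver.Ring.NaturalCoefficients.Default
open import Data.Bool using (if_then_else_)
open import Data.Fin using (Fin; zero; suc)
import Data.Fin.Properties as Fin
open import Data.Fin.Subset using (Subset; _∈_; ∣_∣)
open import Data.List using (List; []; _∷_; _++_; length; lookup; map; filter; tabulate; cartesianProduct; deduplicate; allFin; downFrom)
open import Data.List.Membership.Propositional using (find) renaming (_∈_ to _∈ˡ_)
open import Data.List.Membership.Propositional.Properties using (∈-allFin; ∈-downFrom⁺; ∈-downFrom⁻; ∈-lookup; ∈-map⁻; ∈-deduplicate⁻; ∈-filter⁺; ∈-filter⁻; ∈-cartesianProduct⁺)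
import Data.List.Membership.Setoid as SetoidMembership
open import Data.List.Membership.Setoid.Properties using (∈-deduplicate⁺; ∈-map⁺)
open import Data.List.Properties using (length-tabulate; length-downFrom)
open import Data.List.Relation.Unary.All as All using (All; []; _∷_)
open import Data.List.Relation.Unary.AllPairs using (AllPairs; []; _∷_)
open import Data.List.Relation.Unary.AllPairs.Properties using (filter⁺)
open import Data.List.Relation.Unary.Any using (here; there)
open import Data.List.Relation.Unary.Unique.DecSetoid.Properties using (deduplicate-!)
open import Data.List.Relation.Unary.Unique.Propositional.Properties using (allFin⁺; downFrom⁺; cartesianProduct⁺)
import Data.List.Relation.Unary.Unique.Setoid as SetoidUnique
open import Data.Nat using (ℕ; zero; suc; _+_; _*_; _∸_; _^_; _/_; _%_; _≤_; _<_; _≤?_; z≤n; s≤s; NonZero; >-nonZero)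
open import Data.Nat.DivMod using (/-monoˡ-≤; m≡m%n+[m/n]*n; m%n<n; m/n*n≤m)
open import Data.Nat.Logarithm using (⌊log₂_⌋; ⌊log₂⌋-mono-≤)
open import Data.Nat.Properties hiding (_≟_)
open import Data.Nat.Tactic.RingSolver using (solve-∀)
open import Data.Product using (Σ; ∃; _×_; _,_; proj₁; proj₂)
open import Data.Product.Properties using (≡-dec)
open import Data.Sum using (_⊎_; inj₁; inj₂)
import Data.Vec as Vec
open import Data.Vec.Properties using (lookup∘tabulate; []=⇒lookup)
open import Function using (id; _∘_)
open import Level using (0ℓ)
open import Relation.Binary.Bundles using (DecSetoid)
open import Relation.Binary.Definitions using (Symmetric; tri<; tri≈; tri>)
open import Relation.Binary.PropositionalEquality using (_≡_; _≢_; refl; sym; trans; cong; cong₂; subst; module ≡-Reasoning) renaming (setoid to ≡-setoid)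
import Relation.Binary.Reasoning.Setoid
open import Relation.Binary.Structures using (IsStrictTotalOrder)
open import Relation.Nullary using (¬_; Dec; yes; no; does; ¬?; contradiction)
open import Relation.Nullary.Decidable using (_×-dec_)

-- Write φ_y (i , j) = A j + y A i and split A into blocks of q consecutive elements. A line φ_y = const with
-- y ≠ 0 is monotone, so it meets at most 2n/q + 1 of the cells of the grid A × A, whereas at most n²q² ordered
-- pairs of distinct points on such lines share a cell, for all slopes together. This elementary substitute for
-- Szemerédi-Trotter, valid for Cartesian products, bounds for each slope both the energy E(y) of φ_y (using
-- Cauchy-Schwarz on each line) and the number R(y) of incidences of A × A with the lines φ_y = - (1 + y) a, a ∈ A.
--
-- The solutions of (b + c)(d + a) = (b' + c')(d' + a), summed over a, number at most Σ_y R(y) E(y) up to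
-- O(n⁵) degenerate ones, where y = - (d + a) / (d' + a). Grouping the slopes by E(y) ~ (n / x)³ with x = 2 ^ i,
-- and using blocks of size x² for R and x³ for E, the groups contribute O(n⁵ x), in total O(n⁵ n^(1/3)).
-- Hence at least half of the a have O(n⁴ n^(1/3)) collisions, and Cauchy-Schwarz gives at least c n^(5/3)
-- products.

-- Counting inside cells is enough because two points with different abscissae share a line φ_y =
-- const for only one slope, so a pair is paid for once however many slopes there are. The block
-- sizes come from this. With blocks of size q ≤ n, E is at most (3n/q)(n² + J), where J counts the
-- pairs in a common cell. For q = x³ the term 3n³/q is at most half of an energy of size 6n³/x³, so
-- J accounts for the other half, which leaves at most x⁶ slopes at that scale. For R with blocks of
-- size p, the totals x⁶ n²/p and n²p² balance at p = x². The scales stop near x = n^(1/3), where a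
-- block of size x³ would be all of A; the energies left over are O(n²), and the total of R over all
-- slopes is at most n³. The bounds for the scales form a geometric series, so the last one
-- dominates and no logarithm is lost. The slopes 0 and -1 are kept out: horizontal lines are not
-- strictly monotone, and for y = -1 the lines φ_y = - (1 + y) a all coincide. They come from d + a
-- = 0 and d = d′, which account for only O(n⁴) collisions for each a.

private
  variable
    X Y P Q : Set

-- Finite sums and indicators

∑ : List X → (X → ℕ) → ℕ
∑ []       f = 0
∑ (x ∷ xs) f = f x + ∑ xs f

infixr 5 ∑
syntax ∑ xs (λ x → e) = ∑[ x ← xs ] e

∑-mono-∈ : (xs : List X) {f g : X → ℕ} → (∀ {x} → x ∈ˡ xs → f x ≤ g x) → ∑ xs f ≤ ∑ xs g
∑-mono-∈ []       h = z≤n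
∑-mono-∈ (x ∷ xs) h = +-mono-≤ (h (here refl)) (∑-mono-∈ xs (h ∘ there))

∑-mono : (xs : List X) {f g : X → ℕ} → (∀ x → f x ≤ g x) → ∑ xs f ≤ ∑ xs g
∑-mono xs h = ∑-mono-∈ xs (λ {x} _ → h x)

∑-cong : (xs : List X) {f g : X → ℕ} → (∀ x → f x ≡ g x) → ∑ xs f ≡ ∑ xs g
∑-cong []       h = refl
∑-cong (x ∷ xs) h = cong₂ _+_ (h x) (∑-cong xs h)

∑-+ : (xs : List X) (f g : X → ℕ) → (∑[ x ← xs ] (f x + g x)) ≡ ∑ xs f + ∑ xs g
∑-+ []       f g = refl
∑-+ (x ∷ xs) f g = trans (cong (f x + g x +_) (∑-+ xs f g)) (shuffle (f x) (g x) (∑ xs f) (∑ xs g))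
  where
  shuffle : ∀ a b c d → a + b + (c + d) ≡ a + c + (b + d)
  shuffle = solve-∀

∑-*ˡ : (xs : List X) (c : ℕ) (f : X → ℕ) → (∑[ x ← xs ] c * f x) ≡ c * ∑ xs f
∑-*ˡ []       c f = sym (*-zeroʳ c)
∑-*ˡ (x ∷ xs) c f = trans (cong (c * f x +_) (∑-*ˡ xs c f)) (sym (*-distribˡ-+ c (f x) (∑ xs f)))

∑-*ʳ : (xs : List X) (c : ℕ) (f : X → ℕ) → (∑[ x ← xs ] f x * c) ≡ ∑ xs f * c
∑-*ʳ xs c f = trans (∑-cong xs (λ x → *-comm (f x) c)) (trans (∑-*ˡ xs c f) (*-comm c (∑ xs f)))

∑-const : (xs : List X) (c : ℕ) → (∑[ x ← xs ] c) ≡ length xs * c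
∑-const []       c = refl
∑-const (x ∷ xs) c = cong (c +_) (∑-const xs c)

∑-bounded : (xs : List X) {f : X → ℕ} {c : ℕ} → (∀ x → f x ≤ c) → ∑ xs f ≤ length xs * c
∑-bounded xs {c = c} h = ≤-trans (∑-mono xs h) (≤-reflexive (∑-const xs c))

∑-swap : (xs : List X) (ys : List Y) (f : X → Y → ℕ) →
         (∑[ x ← xs ] ∑[ y ← ys ] f x y) ≡ (∑[ y ← ys ] ∑[ x ← xs ] f x y)
∑-swap []       ys f = sym (trans (∑-const ys 0) (*-zeroʳ (length ys)))
∑-swap (x ∷ xs) ys f = trans (cong (∑ ys (f x) +_) (∑-swap xs ys f))
                             (sym (∑-+ ys (f x) (λ y → ∑[ x ← xs ] f x y)))

∑-product : (xs : List X) (ys : List Y) (f : X → ℕ) (g : Y → ℕ) →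
            ∑ xs f * ∑ ys g ≡ (∑[ x ← xs ] ∑[ y ← ys ] f x * g y)
∑-product xs ys f g = trans (sym (∑-*ʳ xs (∑ ys g) f)) (∑-cong xs (λ x → sym (∑-*ˡ ys (f x) g)))

∑-++ : (xs ys : List X) (f : X → ℕ) → ∑ (xs ++ ys) f ≡ ∑ xs f + ∑ ys f
∑-++ []       ys f = refl
∑-++ (x ∷ xs) ys f = trans (cong (f x +_) (∑-++ xs ys f)) (sym (+-assoc (f x) _ _))

∑-map : (g : X → Y) (xs : List X) (f : Y → ℕ) → ∑ (map g xs) f ≡ ∑ xs (f ∘ g)
∑-map g []       f = refl
∑-map g (x ∷ xs) f = cong (f (g x) +_) (∑-map g xs f)

∑-cartesianProduct : (xs : List X) (ys : List Y) (f : X × Y → ℕ) →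
                     ∑ (cartesianProduct xs ys) f ≡ (∑[ x ← xs ] ∑[ y ← ys ] f (x , y))
∑-cartesianProduct []       ys f = refl
∑-cartesianProduct (x ∷ xs) ys f =
  trans (∑-++ (map (x ,_) ys) _ f)
        (cong₂ _+_ (∑-map (x ,_) ys f) (∑-cartesianProduct xs ys f))

length-cartesianProduct : (xs : List X) (ys : List Y) → length (cartesianProduct xs ys) ≡ length xs * length ys
length-cartesianProduct xs ys = begin
  length (cartesianProduct xs ys)                 ≡⟨ ∑-1 (cartesianProduct xs ys) ⟨
  (∑[ p ← cartesianProduct xs ys ] 1)             ≡⟨ ∑-cartesianProduct xs ys _ ⟩
  (∑[ x ← xs ] ∑[ y ← ys ] 1)                     ≡⟨ ∑-const xs _ ⟩
  length xs * (∑[ y ← ys ] 1)                     ≡⟨ cong (length xs *_) (∑-1 ys) ⟩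
  length xs * length ys                           ∎
  where
  open ≡-Reasoning
  ∑-1 : {Z : Set} (zs : List Z) → (∑[ z ← zs ] 1) ≡ length zs
  ∑-1 zs = trans (∑-const zs 1) (*-identityʳ (length zs))

∑-member : {xs : List X} (f : X → ℕ) {x : X} → x ∈ˡ xs → f x ≤ ∑ xs f
∑-member f (here refl) = m≤m+n _ _
∑-member f (there x∈xs) = ≤-trans (∑-member f x∈xs) (m≤n+m _ _)

𝟙 : {P : Set} → Dec P → ℕ
𝟙 P? = if does P? then 1 else 0

𝟙-yes : (P? : Dec P) → P → 𝟙 P? ≡ 1
𝟙-yes (yes _) p = refl
𝟙-yes (no ¬p) p = contradiction p ¬p

𝟙-no : (P? : Dec P) → ¬ P → 𝟙 P? ≡ 0
𝟙-no (yes p) ¬p = contradiction p ¬p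
𝟙-no (no _)  ¬p = refl

𝟙≤1 : (P? : Dec P) → 𝟙 P? ≤ 1
𝟙≤1 (yes _) = s≤s z≤n
𝟙≤1 (no _)  = z≤n

𝟙*-≤ : (P? : Dec P) → ∀ {k l} → (P → k ≤ l) → 𝟙 P? * k ≤ l
𝟙*-≤ (yes p) h = ≤-trans (≤-reflexive (*-identityˡ _)) (h p)
𝟙*-≤ (no _)  h = z≤n

𝟙-≤ : (P? : Dec P) → ∀ {l} → (P → 1 ≤ l) → 𝟙 P? ≤ l
𝟙-≤ P? h = ≤-trans (≤-reflexive (sym (*-identityʳ _))) (𝟙*-≤ P? h)

𝟙-mono : (P? : Dec P) (Q? : Dec Q) → (P → Q) → 𝟙 P? ≤ 𝟙 Q?
𝟙-mono P? Q? f = 𝟙-≤ P? (λ p → ≤-reflexive (sym (𝟙-yes Q? (f p))))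

𝟙-complement : (P? : Dec P) → 𝟙 P? + 𝟙 (¬? P?) ≡ 1
𝟙-complement (yes _) = refl
𝟙-complement (no _)  = refl

-- The relation `_#_` is abstract so that one bound serves both indices or points that are unequal
-- and field elements that are inequivalent.
∑-𝟙≤1 : {P : X → Set} {_#_ : X → X → Set} (P? : ∀ x → Dec (P x)) {xs : List X} → AllPairs _#_ xs →
        (∀ {x y} → P x → P y → ¬ (x # y)) → (∑[ x ← xs ] 𝟙 (P? x)) ≤ 1
∑-𝟙≤1 P? [] h = z≤n
∑-𝟙≤1 {P = P} {_#_} P? {x ∷ xs} (x# ∷ pairs) h with P? x
... | no _  = ∑-𝟙≤1 P? pairs h
... | yes p = s≤s (none x#)
  where
  none : ∀ {ys} → All (x #_) ys → (∑[ y ← ys ] 𝟙 (P? y)) ≤ 0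
  none []        = z≤n
  none (x#y ∷ #s) = +-mono-≤ (≤-reflexive (𝟙-no (P? _) (λ q → h p q x#y))) (none #s)

-- Lowering both arguments by one changes both sides by the same amount, so induction on the two
-- together avoids squaring a truncated difference.
2*m*n≤m*m+n*n : ∀ m n → 2 * (m * n) ≤ m * m + n * n
2*m*n≤m*m+n*n zero    n       = z≤n
2*m*n≤m*m+n*n (suc m) zero    = ≤-trans (≤-reflexive (cong (2 *_) (*-zeroʳ m))) z≤n
2*m*n≤m*m+n*n (suc m) (suc n) = begin
  2 * (suc m * suc n)                          ≡⟨ expandˡ m n ⟩
  2 * (m * n) + (2 + 2 * m + 2 * n)            ≤⟨ +-monoˡ-≤ _ (2*m*n≤m*m+n*n m n) ⟩
  m * m + n * n + (2 + 2 * m + 2 * n)          ≡⟨ expandʳ m n ⟩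
  suc m * suc m + suc n * suc n                ∎
  where
  open ≤-Reasoning
  expandˡ : ∀ m n → 2 * (suc m * suc n) ≡ 2 * (m * n) + (2 + 2 * m + 2 * n)
  expandˡ = solve-∀
  expandʳ : ∀ m n → m * m + n * n + (2 + 2 * m + 2 * n) ≡ suc m * suc m + suc n * suc n
  expandʳ = solve-∀

-- The square of the sum is a double sum of products, to which the previous inequality applies term
-- by term; the factor 2 is cancelled at the end.
∑-cauchySchwarz : (xs : List X) (f : X → ℕ) → ∑ xs f * ∑ xs f ≤ length xs * (∑[ x ← xs ] f x * f x)
∑-cauchySchwarz xs f = *-cancelˡ-≤ 2 (begin
  2 * (∑ xs f * ∑ xs f)                                 ≡⟨ cong (2 *_) (∑-product xs xs f f) ⟩
  2 * (∑[ x ← xs ] ∑[ y ← xs ] f x * f y)               ≡⟨ ∑-*ˡ xs 2 _ ⟨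
  (∑[ x ← xs ] 2 * (∑[ y ← xs ] f x * f y))             ≡⟨ ∑-cong xs (λ x → ∑-*ˡ xs 2 _) ⟨
  (∑[ x ← xs ] ∑[ y ← xs ] 2 * (f x * f y))             ≤⟨ ∑-mono xs (λ x → ∑-mono xs (λ y → 2*m*n≤m*m+n*n (f x) (f y))) ⟩
  (∑[ x ← xs ] ∑[ y ← xs ] (f x * f x + f y * f y))     ≡⟨ ∑-cong xs (λ x → ∑-+ xs _ _) ⟩
  (∑[ x ← xs ] ((∑[ y ← xs ] f x * f x) + S))           ≡⟨ ∑-+ xs _ _ ⟩
  (∑[ x ← xs ] ∑[ y ← xs ] f x * f x) + (∑[ x ← xs ] S) ≡⟨ cong (_+ (∑[ x ← xs ] S)) (∑-swap xs xs (λ x _ → f x * f x)) ⟩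
  (∑[ x ← xs ] S) + (∑[ x ← xs ] S)                     ≡⟨ cong (λ s → s + s) (∑-const xs S) ⟩
  length xs * S + length xs * S                         ≡⟨ cong (length xs * S +_) (+-identityʳ _) ⟨
  2 * (length xs * S)                                   ∎)
  where
  open ≤-Reasoning
  S = ∑[ y ← xs ] f y * f y

-- Collisions of maps into a decidable setoid

module Collisions (S : DecSetoid 0ℓ 0ℓ) where

  open DecSetoid S using (Carrier; _≈_; _≟_; setoid) renaming (refl to ≈-refl; sym to ≈-sym; trans to ≈-trans)
  open SetoidUnique setoid using (Unique)
  open SetoidMembership setoid using () renaming (_∈_ to _∈ₛ_)

  δ : Carrier → Carrier → ℕ
  δ x y = 𝟙 (x ≟ y)

  δ-cong : ∀ {x y u v} → (x ≈ y → u ≈ v) → δ x y ≤ δ u v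
  δ-cong = 𝟙-mono (_ ≟ _) (_ ≟ _)

  δ-cover : ∀ {cs} x → x ∈ₛ cs → 1 ≤ ∑ cs (δ x)
  δ-cover x (here x≈c)   = ≤-trans (≤-reflexive (sym (𝟙-yes (x ≟ _) x≈c))) (m≤m+n _ _)
  δ-cover x (there x∈cs) = ≤-trans (δ-cover x x∈cs) (m≤n+m _ _)

  -- With `δ-merge`, this factors the relation `x ≈ y` through a list of representatives. Splitting
  -- needs the list to cover `x`, merging needs it to be free of repetitions.
  δ-split : ∀ cs x y → x ∈ₛ cs → δ x y ≤ (∑[ c ← cs ] δ x c * δ y c)
  δ-split cs x y x∈cs = 𝟙-≤ (x ≟ y) (λ x≈y → ≤-trans (δ-cover x x∈cs) (∑-mono cs (λ c →
    𝟙-≤ (x ≟ c) (λ x≈c → ≤-reflexive (sym (cong₂ _*_ (𝟙-yes (x ≟ c) x≈c)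
                                                       (𝟙-yes (y ≟ c) (≈-trans (≈-sym x≈y) x≈c))))))))

  δ-merge : ∀ {cs} → Unique cs → ∀ x y → (∑[ c ← cs ] δ x c * δ y c) ≤ δ x y
  δ-merge {cs} cs! x y with x ≟ y
  ... | yes _   = ≤-trans (∑-mono cs (λ c → 𝟙*-≤ (x ≟ c) (λ x≈c → ≤-trans (𝟙≤1 (y ≟ c)) (≤-reflexive (sym (𝟙-yes (x ≟ c) x≈c))))))
                          (∑-𝟙≤1 (x ≟_) cs! (λ x≈c x≈d c≉d → c≉d (≈-trans (≈-sym x≈c) x≈d)))
  ... | no x≉y = ≤-trans (∑-mono cs (λ c → 𝟙*-≤ (x ≟ c) (λ x≈c → ≤-reflexive (𝟙-no (y ≟ c) (λ y≈c → x≉y (≈-trans x≈c (≈-sym y≈c)))))))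
                         (≤-reflexive (trans (∑-const cs 0) (*-zeroʳ (length cs))))

  -- The weight `u` allows the count to be confined to part of `ps`, such as the points on one line.
  fibre : List X → (X → ℕ) → (X → Carrier) → Carrier → ℕ
  fibre ps u φ c = ∑[ p ← ps ] u p * δ (φ p) c

  fibre-product : (ps : List X) (u : X → ℕ) (φ : X → Carrier) (qs : List Y) (v : Y → ℕ) (ψ : Y → Carrier) (cs : List Carrier) →
    (∑[ c ← cs ] fibre ps u φ c * fibre qs v ψ c) ≡
    (∑[ p ← ps ] ∑[ q ← qs ] u p * v q * (∑[ c ← cs ] δ (φ p) c * δ (ψ q) c))
  fibre-product ps u φ qs v ψ cs = begin
    (∑[ c ← cs ] fibre ps u φ c * fibre qs v ψ c)
      ≡⟨ ∑-cong cs (λ c → ∑-product ps qs _ _) ⟩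
    (∑[ c ← cs ] ∑[ p ← ps ] ∑[ q ← qs ] u p * δ (φ p) c * (v q * δ (ψ q) c))
      ≡⟨ ∑-swap cs ps _ ⟩
    (∑[ p ← ps ] ∑[ c ← cs ] ∑[ q ← qs ] u p * δ (φ p) c * (v q * δ (ψ q) c))
      ≡⟨ ∑-cong ps (λ p → ∑-swap cs qs _) ⟩
    (∑[ p ← ps ] ∑[ q ← qs ] ∑[ c ← cs ] u p * δ (φ p) c * (v q * δ (ψ q) c))
      ≡⟨ ∑-cong ps (λ p → ∑-cong qs (λ q →
           trans (∑-cong cs (λ c → shuffle (u p) (δ (φ p) c) (v q) (δ (ψ q) c)))
                 (∑-*ˡ cs (u p * v q) _))) ⟩
    (∑[ p ← ps ] ∑[ q ← qs ] u p * v q * (∑[ c ← cs ] δ (φ p) c * δ (ψ q) c)) ∎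
    where
    open ≡-Reasoning
    shuffle : ∀ a b c d → a * b * (c * d) ≡ a * c * (b * d)
    shuffle = solve-∀

  module _ (ps : List X) (φ : X → Carrier) {cs : List Carrier} (cs! : Unique cs) (u : X → ℕ) where

    ∑-fibre² : (∑[ c ← cs ] fibre ps u φ c * fibre ps u φ c) ≤ (∑[ p ← ps ] ∑[ q ← ps ] u p * u q * δ (φ p) (φ q))
    ∑-fibre² = ≤-trans (≤-reflexive (fibre-product ps u φ ps u φ cs))
      (∑-mono ps (λ p → ∑-mono ps (λ q → *-monoʳ-≤ (u p * u q) (δ-merge cs! (φ p) (φ q)))))

    module _ (covered : ∀ {p} → p ∈ˡ ps → φ p ∈ₛ cs) where

      ∑-fibre : ∑ ps u ≤ ∑ cs (fibre ps u φ)
      ∑-fibre = ≤-trans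
        (∑-mono-∈ ps (λ {p} p∈ps → ≤-trans (≤-reflexive (sym (*-identityʳ (u p))))
                                    (≤-trans (*-monoʳ-≤ (u p) (δ-cover (φ p) (covered p∈ps)))
                                             (≤-reflexive (sym (∑-*ˡ cs (u p) (δ (φ p))))))))
        (≤-reflexive (∑-swap ps cs _))

      fibre-cauchySchwarz : ∑ ps u * ∑ ps u ≤ length cs * (∑[ p ← ps ] ∑[ q ← ps ] u p * u q * δ (φ p) (φ q))
      fibre-cauchySchwarz = ≤-trans (*-mono-≤ ∑-fibre ∑-fibre)
        (≤-trans (∑-cauchySchwarz cs _) (*-monoʳ-≤ (length cs) ∑-fibre²))

      -- Summing 2k ≤ 1 + k² over the fibre sizes k gives a bound that is additive in the number of
      -- colours, where Cauchy-Schwarz would be multiplicative.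
      fibre-linear : 2 * ∑ ps u ≤ length cs + (∑[ p ← ps ] ∑[ q ← ps ] u p * u q * δ (φ p) (φ q))
      fibre-linear = begin
        2 * ∑ ps u                                                          ≤⟨ *-monoʳ-≤ 2 ∑-fibre ⟩
        2 * ∑ cs (fibre ps u φ)                                             ≡⟨ ∑-*ˡ cs 2 _ ⟨
        (∑[ c ← cs ] 2 * fibre ps u φ c)                                    ≡⟨ ∑-cong cs (λ c → cong (2 *_) (*-identityˡ (fibre ps u φ c))) ⟨
        (∑[ c ← cs ] 2 * (1 * fibre ps u φ c))                              ≤⟨ ∑-mono cs (λ c → 2*m*n≤m*m+n*n 1 (fibre ps u φ c)) ⟩
        (∑[ c ← cs ] (1 + fibre ps u φ c * fibre ps u φ c))                 ≡⟨ ∑-+ cs _ _ ⟩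
        (∑[ c ← cs ] 1) + (∑[ c ← cs ] fibre ps u φ c * fibre ps u φ c)     ≤⟨ +-mono-≤ (≤-reflexive (trans (∑-const cs 1) (*-identityʳ _))) ∑-fibre² ⟩
        length cs + (∑[ p ← ps ] ∑[ q ← ps ] u p * u q * δ (φ p) (φ q))     ∎
        where open ≤-Reasoning

  module _ (ps : List X) (φ : X → Carrier) where

    values : List Carrier
    values = deduplicate _≟_ (map φ ps)

    values! : Unique values
    values! = deduplicate-! S (map φ ps)

    ∈-values : ∀ {p} → p ∈ˡ ps → φ p ∈ₛ values
    ∈-values p∈ps = ∈-deduplicate⁺ setoid _≟_ (λ z≈y x≈y → ≈-trans x≈y (≈-sym z≈y)) (∈-map⁺ (≡-setoid _) setoid (λ { refl → ≈-refl }) p∈ps)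

  collisions : List X → (X → Carrier) → List Y → (Y → Carrier) → ℕ
  collisions ps φ qs ψ = ∑[ p ← ps ] ∑[ q ← qs ] δ (φ p) (ψ q)

  -- The mixed collisions are the inner product of the two multiplicity functions. The values of `φ`
  -- suffice as index set, because a mixed collision happens at such a value.
  collisions-amGm : (ps : List X) (φ : X → Carrier) (qs : List Y) (ψ : Y → Carrier) →
                    2 * collisions ps φ qs ψ ≤ collisions ps φ ps φ + collisions qs ψ qs ψ
  collisions-amGm ps φ qs ψ = begin
    2 * collisions ps φ qs ψ
      ≤⟨ *-monoʳ-≤ 2 (∑-mono-∈ ps (λ p∈ps → ∑-mono qs (λ q → ≤-trans (δ-split ys _ (ψ q) (∈-values ps φ p∈ps)) (≤-reflexive (sym (*-identityˡ _)))))) ⟩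
    2 * (∑[ p ← ps ] ∑[ q ← qs ] 1 * 1 * (∑[ y ← ys ] δ (φ p) y * δ (ψ q) y))
      ≡⟨ cong (2 *_) (fibre-product ps (λ _ → 1) φ qs (λ _ → 1) ψ ys) ⟨
    2 * (∑[ y ← ys ] F y * G y)
      ≡⟨ ∑-*ˡ ys 2 _ ⟨
    (∑[ y ← ys ] 2 * (F y * G y))
      ≤⟨ ∑-mono ys (λ y → 2*m*n≤m*m+n*n (F y) (G y)) ⟩
    (∑[ y ← ys ] (F y * F y + G y * G y))
      ≡⟨ ∑-+ ys _ _ ⟩
    (∑[ y ← ys ] F y * F y) + (∑[ y ← ys ] G y * G y)
      ≤⟨ +-mono-≤ (∑-fibre² ps φ (values! ps φ) (λ _ → 1)) (∑-fibre² qs ψ (values! ps φ) (λ _ → 1)) ⟩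
    (∑[ p ← ps ] ∑[ q ← ps ] 1 * 1 * δ (φ p) (φ q)) + (∑[ p ← qs ] ∑[ q ← qs ] 1 * 1 * δ (ψ p) (ψ q))
      ≡⟨ cong₂ _+_ (∑-cong ps (λ p → ∑-cong ps (λ q → *-identityˡ _))) (∑-cong qs (λ p → ∑-cong qs (λ q → *-identityˡ _))) ⟩
    collisions ps φ ps φ + collisions qs ψ qs ψ ∎
    where
    open ≤-Reasoning
    ys = values ps φ
    F = fibre ps (λ _ → 1) φ
    G = fibre qs (λ _ → 1) ψ

  collisions≤values*collisions : (ps : List X) (φ : X → Carrier) →
    length ps * length ps ≤ length (values ps φ) * collisions ps φ ps φ
  collisions≤values*collisions ps φ = begin
    length ps * length ps ≡⟨ cong (λ k → k * k) (trans (∑-const ps 1) (*-identityʳ (length ps))) ⟨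
    ∑ ps (λ _ → 1) * ∑ ps (λ _ → 1) ≤⟨ fibre-cauchySchwarz ps φ (values! ps φ) (λ _ → 1) (∈-values ps φ) ⟩
    length (values ps φ) * (∑[ p ← ps ] ∑[ q ← ps ] 1 * 1 * δ (φ p) (φ q))
      ≡⟨ cong (length (values ps φ) *_) (∑-cong ps (λ p → ∑-cong ps (λ q → *-identityˡ _))) ⟩
    length (values ps φ) * collisions ps φ ps φ ∎
    where open ≤-Reasoning

-- Cauchy-Schwarz on each level set of φ.
module _ (S T : DecSetoid 0ℓ 0ℓ) where
  private
    module S = Collisions S
    module T = Collisions T
    open DecSetoid T using () renaming (setoid to setoidᵀ)
    open SetoidUnique setoidᵀ using (Unique)
    open SetoidMembership setoidᵀ using () renaming (_∈_ to _∈ₜ_)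

  collisions≤colours*monochromatic :
    (ps : List X) (φ : X → DecSetoid.Carrier S) (col : X → DecSetoid.Carrier T) {cs : List (DecSetoid.Carrier T)} → Unique cs →
    (∀ {p} → p ∈ˡ ps → col p ∈ₜ cs) →
    S.collisions ps φ ps φ ≤ length cs * (∑[ p ← ps ] ∑[ q ← ps ] S.δ (φ p) (φ q) * T.δ (col p) (col q))
  collisions≤colours*monochromatic ps φ col {cs} cs! covered = begin
    S.collisions ps φ ps φ
      ≤⟨ ∑-mono-∈ ps (λ p∈ps → ∑-mono ps (λ q → S.δ-split ys _ (φ q) (S.∈-values ps φ p∈ps))) ⟩
    (∑[ p ← ps ] ∑[ q ← ps ] ∑[ y ← ys ] f y p * f y q)
      ≡⟨ trans (∑-cong ps (λ p → ∑-swap ps ys _)) (∑-swap ps ys _) ⟩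
    (∑[ y ← ys ] ∑[ p ← ps ] ∑[ q ← ps ] f y p * f y q)
      ≡⟨ ∑-cong ys (λ y → ∑-product ps ps (f y) (f y)) ⟨
    (∑[ y ← ys ] ∑ ps (f y) * ∑ ps (f y))
      ≤⟨ ∑-mono ys (λ y → T.fibre-cauchySchwarz ps col cs! (f y) covered) ⟩
    (∑[ y ← ys ] length cs * (∑[ p ← ps ] ∑[ q ← ps ] f y p * f y q * T.δ (col p) (col q)))
      ≡⟨ ∑-*ˡ ys (length cs) _ ⟩
    length cs * (∑[ y ← ys ] ∑[ p ← ps ] ∑[ q ← ps ] f y p * f y q * T.δ (col p) (col q))
      ≡⟨ cong (length cs *_) (trans (∑-swap ys ps _) (∑-cong ps (λ p → ∑-swap ys ps _))) ⟩
    length cs * (∑[ p ← ps ] ∑[ q ← ps ] ∑[ y ← ys ] f y p * f y q * T.δ (col p) (col q))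
      ≤⟨ *-monoʳ-≤ (length cs) (∑-mono ps (λ p → ∑-mono ps (λ q →
           ≤-trans (≤-reflexive (∑-*ʳ ys (T.δ (col p) (col q)) _))
                   (*-monoˡ-≤ (T.δ (col p) (col q)) (S.δ-merge (S.values! ps φ) (φ p) (φ q)))))) ⟩
    length cs * (∑[ p ← ps ] ∑[ q ← ps ] S.δ (φ p) (φ q) * T.δ (col p) (col q)) ∎
    where
    open ≤-Reasoning
    ys = S.values ps φ
    f = λ y p → S.δ (φ p) y

-- Lines in an ordered field

module OrderedField (ℝ : RealNumbers) where

  open RealNumbers ℝ public
    using (Carrier; _≈_; 0#; 1#; isEquivalence)
    renaming ( _+_ to infixl 6 _⊕_; _*_ to infixl 7 _⊗_; -_ to infix 8 ⊖_; _<_ to infix 4 _≺_; _≟_ to infix 4 _≟ᴿ_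
             ; refl to ≈-refl; sym to ≈-sym; trans to ≈-trans )
  open RealNumbers ℝ
    using ( inverse; *-pos; commutativeSemiring; setoid; ring; +-group
          ; zeroˡ; zeroʳ; distribˡ; -‿inverseˡ; -‿inverseʳ )
    renaming ( <-isStrictTotalOrder to ≺-isStrictTotalOrder; +-mono-< to ⊕-monoˡ-≺; +-comm to ⊕-comm; +-identityˡ to ⊕-identityˡ; +-congˡ to ⊕-congˡ; +-congʳ to ⊕-congʳ
             ; *-comm to ⊗-comm; *-assoc to ⊗-assoc; *-identityʳ to ⊗-identityʳ; *-congˡ to ⊗-congˡ; *-congʳ to ⊗-congʳ )
  open IsStrictTotalOrder ≺-isStrictTotalOrder public
    using (compare) renaming (_<?_ to infix 4 _≺?_; trans to ≺-trans; irrefl to ≺-irrefl)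
  open IsStrictTotalOrder ≺-isStrictTotalOrder using (<-resp-≈)
  open Algebra.Properties.Group +-group public using ()
    renaming (∙-cancelˡ to ⊕-cancelˡ; ∙-cancelʳ to ⊕-cancelʳ; inverseʳ-unique to ⊖-unique; ⁻¹-injective to ⊖-injective)
  open Algebra.Properties.Ring ring using (-‿distribʳ-*)
  open Algebra.Solver.Ring.NaturalCoefficients.Default commutativeSemiring using (solve; _:=_; _:+_; _:*_; con)
  open Relation.Binary.Reasoning.Setoid setoid

  ≺-resp : ∀ {x x′ y y′} → x ≈ x′ → y ≈ y′ → x ≺ y → x′ ≺ y′
  ≺-resp x≈ y≈ x≺y = proj₁ <-resp-≈ y≈ (proj₂ <-resp-≈ x≈ x≺y)

  ⊕-cancelʳ-≺ : ∀ {x y} z → x ⊕ z ≺ y ⊕ z → x ≺ y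
  ⊕-cancelʳ-≺ {x} {y} z h = ≺-resp (undo x) (undo y) (⊕-monoˡ-≺ (⊖ z) h)
    where
    undo : ∀ x → x ⊕ z ⊕ ⊖ z ≈ x
    undo x = begin
      x ⊕ z ⊕ ⊖ z   ≈⟨ solve 3 (λ x z m → x :+ z :+ m := (z :+ m) :+ x) ≈-refl x z (⊖ z) ⟩
      (z ⊕ ⊖ z) ⊕ x ≈⟨ ⊕-congʳ (-‿inverseʳ z) ⟩
      0# ⊕ x        ≈⟨ ⊕-identityˡ x ⟩
      x             ∎

  ⊗-monoˡ-≺ : ∀ {y u v} → 0# ≺ y → u ≺ v → y ⊗ u ≺ y ⊗ v
  ⊗-monoˡ-≺ {y} {u} {v} 0≺y u≺v = ≺-resp (⊕-identityˡ (y ⊗ u)) eq (⊕-monoˡ-≺ (y ⊗ u) (*-pos 0≺y 0≺v-u))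
    where
    0≺v-u : 0# ≺ v ⊕ ⊖ u
    0≺v-u = ≺-resp (-‿inverseʳ u) ≈-refl (⊕-monoˡ-≺ (⊖ u) u≺v)
    eq : y ⊗ (v ⊕ ⊖ u) ⊕ y ⊗ u ≈ y ⊗ v
    eq = begin
      y ⊗ (v ⊕ ⊖ u) ⊕ y ⊗ u ≈⟨ solve 4 (λ y v m u → y :* (v :+ m) :+ y :* u := y :* v :+ y :* (m :+ u)) ≈-refl y v (⊖ u) u ⟩
      y ⊗ v ⊕ y ⊗ (⊖ u ⊕ u) ≈⟨ ⊕-congˡ (≈-trans (⊗-congˡ (-‿inverseˡ u)) (zeroʳ y)) ⟩
      y ⊗ v ⊕ 0#            ≈⟨ ≈-trans (⊕-comm _ _) (⊕-identityˡ _) ⟩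
      y ⊗ v                 ∎

  ⊗-antiˡ-≺ : ∀ {y u v} → y ≺ 0# → u ≺ v → y ⊗ v ≺ y ⊗ u
  ⊗-antiˡ-≺ {y} {u} {v} y≺0 u≺v = ≺-resp (add v u) (≈-trans (⊕-congˡ (⊕-comm _ _)) (add u v)) (⊕-monoˡ-≺ (y ⊗ u ⊕ y ⊗ v) (⊗-monoˡ-≺ 0≺-y u≺v) )
    where
    0≺-y : 0# ≺ ⊖ y
    0≺-y = ≺-resp (-‿inverseʳ y) (⊕-identityˡ (⊖ y)) (⊕-monoˡ-≺ (⊖ y) y≺0)
    add : ∀ u v → ⊖ y ⊗ v ⊕ (y ⊗ v ⊕ y ⊗ u) ≈ y ⊗ u
    add u v = begin
      ⊖ y ⊗ v ⊕ (y ⊗ v ⊕ y ⊗ u) ≈⟨ solve 4 (λ m y u v → m :* v :+ (y :* v :+ y :* u) := (m :+ y) :* v :+ y :* u) ≈-refl (⊖ y) y u v ⟩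
      (⊖ y ⊕ y) ⊗ v ⊕ y ⊗ u     ≈⟨ ⊕-congʳ (≈-trans (⊗-congʳ (-‿inverseˡ y)) (zeroˡ v)) ⟩
      0# ⊕ y ⊗ u                ≈⟨ ⊕-identityˡ _ ⟩
      y ⊗ u                     ∎

  ⊗-cancelʳ : ∀ {x y} z → ¬ (z ≈ 0#) → x ⊗ z ≈ y ⊗ z → x ≈ y
  ⊗-cancelʳ {x} {y} z z≉0 xz≈yz with z⁻¹ , zz⁻¹≈1 ← inverse z z≉0 = begin
    x             ≈⟨ undo x ⟨
    x ⊗ z ⊗ z⁻¹   ≈⟨ ⊗-congʳ xz≈yz ⟩
    y ⊗ z ⊗ z⁻¹   ≈⟨ undo y ⟩
    y             ∎
    where
    undo : ∀ x → x ⊗ z ⊗ z⁻¹ ≈ x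
    undo x = ≈-trans (⊗-assoc x z z⁻¹) (≈-trans (⊗-congˡ zz⁻¹≈1) (⊗-identityʳ x))

  ⊗-cancelˡ : ∀ {x y} z → ¬ (z ≈ 0#) → z ⊗ x ≈ z ⊗ y → x ≈ y
  ⊗-cancelˡ z z≉0 zx≈zy = ⊗-cancelʳ z z≉0 (≈-trans (⊗-comm _ z) (≈-trans zx≈zy (⊗-comm z _)))

  -- The line of slope - y through the point (u , v) meets the vertical axis at height v ⊕ y ⊗ u.
  intercept-decreasing : ∀ {y u v u′ v′} → 0# ≺ y → v ⊕ y ⊗ u ≈ v′ ⊕ y ⊗ u′ → u ≺ u′ → v′ ≺ v
  intercept-decreasing {y} {u} {v} {u′} {v′} 0≺y eq u≺u′ =
    ⊕-cancelʳ-≺ (y ⊗ u) (≺-resp (⊕-comm _ _) (≈-trans (⊕-comm _ _) (≈-sym eq)) (⊕-monoˡ-≺ v′ (⊗-monoˡ-≺ 0≺y u≺u′)))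

  intercept-increasing : ∀ {y u v u′ v′} → y ≺ 0# → v ⊕ y ⊗ u ≈ v′ ⊕ y ⊗ u′ → u ≺ u′ → v ≺ v′
  intercept-increasing {y} {u} {v} {u′} {v′} y≺0 eq u≺u′ =
    ⊕-cancelʳ-≺ (y ⊗ u′) (≺-resp (⊕-comm _ _) (≈-trans (⊕-comm _ _) eq) (⊕-monoˡ-≺ v (⊗-antiˡ-≺ y≺0 u≺u′)))

  intercept-injectiveˡ : ∀ {y u v v′} → v ⊕ y ⊗ u ≈ v′ ⊕ y ⊗ u → v ≈ v′
  intercept-injectiveˡ eq = ⊕-cancelʳ _ _ _ eq

  intercept-injectiveʳ : ∀ {y u u′ v} → ¬ (y ≈ 0#) → v ⊕ y ⊗ u ≈ v ⊕ y ⊗ u′ → u ≈ u′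
  intercept-injectiveʳ y≉0 eq = ⊗-cancelˡ _ y≉0 (⊕-cancelˡ _ _ _ eq)

  -- Both slopes solve y (u - u′) = v′ - v, whose coefficient is nonzero.
  slope-unique : ∀ {y z u u′ v v′} → ¬ (u ≈ u′) → v ⊕ y ⊗ u ≈ v′ ⊕ y ⊗ u′ → v ⊕ z ⊗ u ≈ v′ ⊕ z ⊗ u′ → y ≈ z
  slope-unique {y} {z} {u} {u′} {v} {v′} u≉u′ eqy eqz = ⊗-cancelʳ (u ⊕ ⊖ u′) u-u′≉0 (begin
    y ⊗ (u ⊕ ⊖ u′)          ≈⟨ unfold y ⟩
    y ⊗ u ⊕ ⊖ (y ⊗ u′)      ≈⟨ differ eqy ⟩
    v′ ⊕ ⊖ v                ≈⟨ differ eqz ⟨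
    z ⊗ u ⊕ ⊖ (z ⊗ u′)      ≈⟨ unfold z ⟨
    z ⊗ (u ⊕ ⊖ u′)          ∎)
    where
    u-u′≉0 : ¬ (u ⊕ ⊖ u′ ≈ 0#)
    u-u′≉0 h = u≉u′ (⊕-cancelʳ (⊖ u′) _ _ (≈-trans h (≈-sym (-‿inverseʳ u′))))
    unfold : ∀ y → y ⊗ (u ⊕ ⊖ u′) ≈ y ⊗ u ⊕ ⊖ (y ⊗ u′)
    unfold y = ≈-trans (distribˡ y u (⊖ u′)) (⊕-congˡ (≈-sym (-‿distribʳ-* y u′)))
    differ : ∀ {a b} → v ⊕ a ≈ v′ ⊕ b → a ⊕ ⊖ b ≈ v′ ⊕ ⊖ v
    differ {a} {b} h = ⊕-cancelˡ v _ _ (begin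
      v ⊕ (a ⊕ ⊖ b)           ≈⟨ solve 3 (λ v a m → v :+ (a :+ m) := (v :+ a) :+ m) ≈-refl v a (⊖ b) ⟩
      (v ⊕ a) ⊕ ⊖ b           ≈⟨ ⊕-congʳ h ⟩
      v′ ⊕ b ⊕ ⊖ b            ≈⟨ solve 3 (λ v b m → v :+ b :+ m := v :+ (b :+ m)) ≈-refl v′ b (⊖ b) ⟩
      v′ ⊕ (b ⊕ ⊖ b)          ≈⟨ ⊕-congˡ (≈-trans (-‿inverseʳ b) (≈-sym (-‿inverseʳ v))) ⟩
      v′ ⊕ (v ⊕ ⊖ v)          ≈⟨ solve 3 (λ w v m → w :+ (v :+ m) := v :+ (w :+ m)) ≈-refl v′ v (⊖ v) ⟩
      v ⊕ (v′ ⊕ ⊖ v)          ∎)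

  -- Separates the four variables into the points (b , b′) and (c , c′), so that solutions of the
  -- equation become collisions between φ_y and its negative.
  intercept-negate : ∀ {y b c b′ c′} → b′ ⊕ c′ ⊕ y ⊗ (b ⊕ c) ≈ 0# → b′ ⊕ y ⊗ b ≈ ⊖ (c′ ⊕ y ⊗ c)
  intercept-negate {y} {b} {c} {b′} {c′} h = ⊖-unique _ _ (≈-trans
    (solve 5 (λ y b c b′ c′ → c′ :+ y :* c :+ (b′ :+ y :* b) := b′ :+ c′ :+ y :* (b :+ c)) ≈-refl y b c b′ c′) h)

  -- Moving both occurrences of `a` to the right makes the equation an incidence of the point (d′ ,
  -- d) with a line that depends on `a` alone.
  intercept-translate : ∀ {y a d d′} → d ⊕ a ⊕ y ⊗ (d′ ⊕ a) ≈ 0# → d ⊕ y ⊗ d′ ≈ ⊖ ((1# ⊕ y) ⊗ a)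
  intercept-translate {y} {a} {d} {d′} h = ⊖-unique _ _ (≈-trans
    (solve 4 (λ y a d d′ → (con 1 :+ y) :* a :+ (d :+ y :* d′) := d :+ a :+ y :* (d′ :+ a)) ≈-refl y a d d′) h)

  root : ∀ u v → Σ Carrier λ y → ¬ (v ≈ 0#) → u ⊕ y ⊗ v ≈ 0#
  root u v with v ≟ᴿ 0#
  -- The default 0 keeps slopes total on triples; it is discarded later, together with the genuine
  -- slope 0.
  ... | yes v≈0 = 0# , λ v≉0 → contradiction v≈0 v≉0
  ... | no  v≉0 with v⁻¹ , vv⁻¹≈1 ← inverse v v≉0 = ⊖ u ⊗ v⁻¹ , λ _ → begin
    u ⊕ ⊖ u ⊗ v⁻¹ ⊗ v     ≈⟨ solve 4 (λ u m w v → u :+ m :* w :* v := u :+ m :* (v :* w)) ≈-refl u (⊖ u) v⁻¹ v ⟩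
    u ⊕ ⊖ u ⊗ (v ⊗ v⁻¹)   ≈⟨ ⊕-congˡ (≈-trans (⊗-congˡ vv⁻¹≈1) (⊗-identityʳ (⊖ u))) ⟩
    u ⊕ ⊖ u               ≈⟨ -‿inverseʳ u ⟩
    0#                    ∎

  root-unique : ∀ {u v y z} → ¬ (v ≈ 0#) → u ⊕ y ⊗ v ≈ 0# → u ⊕ z ⊗ v ≈ 0# → y ≈ z
  root-unique {u} {v} v≉0 hy hz = ⊗-cancelʳ v v≉0 (⊕-cancelˡ u _ _ (≈-trans hy (≈-sym hz)))

  root-zero : ∀ {u v y} → u ⊕ y ⊗ v ≈ 0# → y ⊗ v ≈ 0# → u ≈ 0#
  root-zero {u} {v} {y} h yv≈0 = begin
    u             ≈⟨ ≈-trans (⊕-comm u 0#) (⊕-identityˡ u) ⟨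
    u ⊕ 0#        ≈⟨ ⊕-congˡ yv≈0 ⟨
    u ⊕ y ⊗ v     ≈⟨ h ⟩
    0#            ∎

  root-of-zero : ∀ {u v y} → u ⊕ y ⊗ v ≈ 0# → v ≈ 0# → u ≈ 0#
  root-of-zero {y = y} h v≈0 = root-zero h (≈-trans (⊗-congˡ v≈0) (zeroʳ y))

  root≉0 : ∀ {u v y} → ¬ (u ≈ 0#) → u ⊕ y ⊗ v ≈ 0# → ¬ (y ≈ 0#)
  root≉0 {v = v} u≉0 h y≈0 = u≉0 (root-zero h (≈-trans (⊗-congʳ y≈0) (zeroˡ v)))

  root≉-1 : ∀ {u v y} → ¬ (u ≈ v) → u ⊕ y ⊗ v ≈ 0# → ¬ (1# ⊕ y ≈ 0#)
  root≉-1 {u} {v} {y} u≉v h 1+y≈0 = u≉v (⊕-cancelʳ (y ⊗ v) u v (begin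
    u ⊕ y ⊗ v       ≈⟨ h ⟩
    0#              ≈⟨ zeroˡ v ⟨
    0# ⊗ v          ≈⟨ ⊗-congʳ 1+y≈0 ⟨
    (1# ⊕ y) ⊗ v    ≈⟨ solve 2 (λ y v → (con 1 :+ y) :* v := v :+ y :* v) ≈-refl y v ⟩
    v ⊕ y ⊗ v       ∎))

  -- Here y = - u / v, so dividing the multiplicative relation by `v` makes it linear in `s` and
  -- `t`, with a coefficient that depends only on the slope.
  root-transfer : ∀ {u v y s t} → ¬ (v ≈ 0#) → u ⊕ y ⊗ v ≈ 0# → s ⊗ u ≈ t ⊗ v → t ⊕ y ⊗ s ≈ 0#
  root-transfer {u} {v} {y} {s} {t} v≉0 h su≈tv = ⊗-cancelʳ v v≉0 (begin
    (t ⊕ y ⊗ s) ⊗ v       ≈⟨ solve 4 (λ t y s v → (t :+ y :* s) :* v := t :* v :+ s :* (y :* v)) ≈-refl t y s v ⟩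
    t ⊗ v ⊕ s ⊗ (y ⊗ v)   ≈⟨ ⊕-congʳ su≈tv ⟨
    s ⊗ u ⊕ s ⊗ (y ⊗ v)   ≈⟨ distribˡ s u (y ⊗ v) ⟨
    s ⊗ (u ⊕ y ⊗ v)       ≈⟨ ⊗-congˡ h ⟩
    s ⊗ 0#                ≈⟨ ≈-trans (zeroʳ s) (≈-sym (zeroˡ v)) ⟩
    0# ⊗ v                ∎)

  translate-injective : ∀ {y a b} → ¬ (1# ⊕ y ≈ 0#) → ⊖ ((1# ⊕ y) ⊗ a) ≈ ⊖ ((1# ⊕ y) ⊗ b) → a ≈ b
  translate-injective 1+y≉0 h = ⊗-cancelˡ _ 1+y≉0 (⊖-injective h)

  root-resp : ∀ {u v y z} → y ≈ z → u ⊕ y ⊗ v ≈ 0# → u ⊕ z ⊗ v ≈ 0#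
  root-resp y≈z h = ≈-trans (⊕-congˡ (⊗-congʳ (≈-sym y≈z))) h

-- Counting indices

∑-𝟙-unique : {n : ℕ} {P : Fin n → Set} (P? : ∀ i → Dec (P i)) → (∀ {i j} → P i → P j → i ≡ j) →
             (∑[ i ← allFin n ] 𝟙 (P? i)) ≤ 1
∑-𝟙-unique {n} P? unique = ∑-𝟙≤1 P? (allFin⁺ n) (λ p q i≢j → i≢j (unique p q))

length-allFin : ∀ n → length (allFin n) ≡ n
length-allFin n = length-tabulate id

-- This separates the cells of a staircase: both coordinates move in the same direction, so equal
-- sums leave no room for either to move.
+-≤-≡ : ∀ {a b c d} → a ≤ b → c ≤ d → a + c ≡ b + d → a ≡ b × c ≡ d
+-≤-≡ {a} {b} {c} {d} a≤b c≤d eq = a≡b , +-cancelˡ-≡ a c d (trans eq (cong (_+ d) (sym a≡b)))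
  where
  a≡b : a ≡ b
  a≡b = ≤-antisym a≤b (+-cancelʳ-≤ d b a (≤-trans (≤-reflexive (sym eq)) (+-monoʳ-≤ a c≤d)))

module ℕ-Collisions = Collisions ≡-decSetoid

-- Blocks of the grid A × A

module Grid (ℝ : RealNumbers) (n : ℕ) (A : Fin n → RealNumbers.Carrier ℝ) (A-injective : IsFiniteSet ℝ n A) where

  open OrderedField ℝ

  decSetoid : DecSetoid 0ℓ 0ℓ
  decSetoid = record
    { Carrier = Carrier ; _≈_ = _≈_
    ; isDecEquivalence = record { isEquivalence = isEquivalence ; _≟_ = _≟ᴿ_ } }

  open Collisions decSetoid public

  -- The enumeration `A` need not be increasing, so its order is recovered by counting smaller
  -- elements; blocks are intervals of ranks.
  rank : Fin n → ℕ
  rank i = ∑[ k ← allFin n ] 𝟙 (A k ≺? A i)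

  rank-mono-< : ∀ {i j} → A i ≺ A j → rank i < rank j
  rank-mono-< {i} {j} Ai≺Aj = begin-strict
    rank i                                                               <⟨ n<1+n (rank i) ⟩
    -- The extra 1 comes from k = i itself, which lies below `A j` but not below `A i`.
    1 + rank i                                                           ≤⟨ +-monoˡ-≤ (rank i) 1≤ ⟩
    (∑[ k ← allFin n ] 𝟙 (k Fin.≟ i)) + rank i                           ≡⟨ ∑-+ (allFin n) _ _ ⟨
    (∑[ k ← allFin n ] (𝟙 (k Fin.≟ i) + 𝟙 (A k ≺? A i)))                 ≤⟨ ∑-mono (allFin n) pointwise ⟩
    rank j                                                               ∎
    where
    open ≤-Reasoning
    1≤ : 1 ≤ (∑[ k ← allFin n ] 𝟙 (k Fin.≟ i))
    1≤ = ≤-trans (≤-reflexive (sym (𝟙-yes (i Fin.≟ i) refl))) (∑-member (λ k → 𝟙 (k Fin.≟ i)) (∈-allFin i))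
    pointwise : ∀ k → 𝟙 (k Fin.≟ i) + 𝟙 (A k ≺? A i) ≤ 𝟙 (A k ≺? A j)
    pointwise k with k Fin.≟ i
    ... | yes refl = ≤-reflexive (trans (cong suc (𝟙-no (A k ≺? A k) (≺-irrefl ≈-refl))) (sym (𝟙-yes (A k ≺? A j) Ai≺Aj)))
    ... | no _     = 𝟙-mono (A k ≺? A i) (A k ≺? A j) (λ Ak≺Ai → ≺-trans Ak≺Ai Ai≺Aj)

  rank-mono-≤ : ∀ {i j} → A i ≺ A j → rank i ≤ rank j
  rank-mono-≤ = <⇒≤ ∘ rank-mono-<

  rank-injective : ∀ {i j} → rank i ≡ rank j → i ≡ j
  rank-injective {i} {j} eq with compare (A i) (A j)
  ... | tri< i≺j _ _ = contradiction eq (<⇒≢ (rank-mono-< i≺j))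
  ... | tri≈ _ i≈j _ = A-injective i j i≈j
  ... | tri> _ _ j≺i = contradiction (sym eq) (<⇒≢ (rank-mono-< j≺i))

  rank≤n : ∀ i → rank i ≤ n
  rank≤n i = ≤-trans (∑-bounded (allFin n) (λ k → 𝟙≤1 (A k ≺? A i))) (≤-reflexive (trans (*-identityʳ _) (length-allFin n)))

  Point : Set
  Point = Fin n × Fin n

  _≟ₚ_ : (p q : Point) → Dec (p ≡ q)
  _≟ₚ_ = ≡-dec Fin._≟_ Fin._≟_

  points : List Point
  points = cartesianProduct (allFin n) (allFin n)

  length-points : length points ≡ n * n
  length-points = trans (length-cartesianProduct (allFin n) (allFin n)) (cong₂ _*_ (length-allFin n) (length-allFin n))

  ∑-diagonal : ∀ p → (∑[ q ← points ] 𝟙 (p ≟ₚ q)) ≤ 1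
  ∑-diagonal p = ∑-𝟙≤1 (p ≟ₚ_) (cartesianProduct⁺ (allFin⁺ n) (allFin⁺ n)) (λ p≡q p≡r q≢r → q≢r (trans (sym p≡q) p≡r))

  intercept : Carrier → Point → Carrier
  intercept y (i , j) = A j ⊕ y ⊗ A i

  energy : Carrier → ℕ
  energy y = collisions points (intercept y) points (intercept y)

  module Blocks (q : ℕ) .{{_ : NonZero q}} where

    block : Fin n → ℕ
    block i = rank i / q

    block-mono : ∀ {i j} → A i ≺ A j → block i ≤ block j
    block-mono Ai≺Aj = /-monoˡ-≤ q (rank-mono-≤ Ai≺Aj)

    blockmates : Fin n → Fin n → ℕ
    blockmates i j = 𝟙 (¬? (i Fin.≟ j)) * ℕ-Collisions.δ (block i) (block j)

    -- A member of block `b` has rank r + b q with r < q, and ranks are injective, so each remainder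
    -- is taken at most once.
    ∑-block≤ : ∀ b → (∑[ i ← allFin n ] ℕ-Collisions.δ b (block i)) ≤ q
    ∑-block≤ b = begin
      (∑[ i ← allFin n ] ℕ-Collisions.δ b (block i))
        ≤⟨ ∑-mono (allFin n) (λ i → 𝟙-≤ (b ≟ block i) (λ b≡ → ≤-trans
             (≤-reflexive (sym (𝟙-yes (rank i ≟ rank i % q + b * q) (trans (m≡m%n+[m/n]*n (rank i) q) (cong (λ b → rank i % q + b * q) (sym b≡))))))
             (∑-member (λ r → 𝟙 (rank i ≟ r + b * q)) (∈-downFrom⁺ (m%n<n (rank i) q))))) ⟩
      (∑[ i ← allFin n ] ∑[ r ← downFrom q ] 𝟙 (rank i ≟ r + b * q))
        ≡⟨ ∑-swap (allFin n) (downFrom q) _ ⟩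
      (∑[ r ← downFrom q ] ∑[ i ← allFin n ] 𝟙 (rank i ≟ r + b * q))
        ≤⟨ ∑-bounded (downFrom q) (λ r → ∑-𝟙-unique (λ i → rank i ≟ r + b * q) (λ eq eq′ → rank-injective (trans eq (sym eq′)))) ⟩
      length (downFrom q) * 1
        ≡⟨ trans (*-identityʳ _) (length-downFrom q) ⟩
      q ∎
      where
      open ≤-Reasoning
      open DecSetoid ≡-decSetoid using (_≟_)

    ∑-blockmates : (∑[ i ← allFin n ] ∑[ j ← allFin n ] blockmates i j) ≤ n * q
    ∑-blockmates = ≤-trans
      (∑-bounded (allFin n) (λ i → ≤-trans
        (∑-mono (allFin n) (λ j → 𝟙*-≤ (¬? (i Fin.≟ j)) (λ _ → ≤-refl)))
        (∑-block≤ (block i))))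
      (≤-reflexive (cong (_* q) (length-allFin n)))

    -- Both coordinates are required to differ. On a line with y ≠ 0 this holds for any two distinct
    -- points, and it makes the number of candidate pairs a product over the two axes.
    joined : Carrier → Point → Point → ℕ
    joined y (i , j) (i′ , j′) = blockmates i i′ * (blockmates j j′ * δ (intercept y (i , j)) (intercept y (i′ , j′)))

    joins : Carrier → ℕ
    joins y = ∑[ p ← points ] ∑[ p′ ← points ] joined y p p′

    -- Distinct abscissae determine the slope, so among inequivalent slopes at most one puts the two
    -- points on a common line.
    ∑-joined : ∀ {ys} → AllPairs (λ y z → ¬ (y ≈ z)) ys → ∀ p p′ →
               (∑[ y ← ys ] joined y p p′) ≤ blockmates (proj₁ p) (proj₁ p′) * blockmates (proj₂ p) (proj₂ p′)
    ∑-joined {ys} ys! (i , j) (i′ , j′) = begin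
      (∑[ y ← ys ] joined y (i , j) (i′ , j′))
        ≡⟨ ∑-*ˡ ys (blockmates i i′) _ ⟩
      blockmates i i′ * (∑[ y ← ys ] blockmates j j′ * L y)
        ≡⟨ cong (blockmates i i′ *_) (∑-*ˡ ys (blockmates j j′) _) ⟩
      blockmates i i′ * (blockmates j j′ * ∑ ys L)
        ≡⟨ *-assoc (𝟙 (¬? (i Fin.≟ i′))) _ _ ⟩
      𝟙 (¬? (i Fin.≟ i′)) * (ℕ-Collisions.δ (block i) (block i′) * (blockmates j j′ * ∑ ys L))
        ≤⟨ bound ⟩
      𝟙 (¬? (i Fin.≟ i′)) * (ℕ-Collisions.δ (block i) (block i′) * (blockmates j j′ * 1))
        ≡⟨ *-assoc (𝟙 (¬? (i Fin.≟ i′))) _ _ ⟨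
      blockmates i i′ * (blockmates j j′ * 1)
        ≡⟨ cong (blockmates i i′ *_) (*-identityʳ _) ⟩
      blockmates i i′ * blockmates j j′ ∎
      where
      open ≤-Reasoning
      L : Carrier → ℕ
      L y = δ (intercept y (i , j)) (intercept y (i′ , j′))
      bound : 𝟙 (¬? (i Fin.≟ i′)) * (ℕ-Collisions.δ (block i) (block i′) * (blockmates j j′ * ∑ ys L)) ≤
              𝟙 (¬? (i Fin.≟ i′)) * (ℕ-Collisions.δ (block i) (block i′) * (blockmates j j′ * 1))
      bound with i Fin.≟ i′
      -- Points with the same abscissa determine no slope; the leading indicator vanishes there,
      -- which is why it was moved to the front.
      ... | yes _   = z≤n
      ... | no i≢i′ = *-monoʳ-≤ 1 (*-monoʳ-≤ (ℕ-Collisions.δ (block i) (block i′)) (*-monoʳ-≤ (blockmates j j′)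
        (∑-𝟙≤1 (λ y → intercept y (i , j) ≟ᴿ intercept y (i′ , j′)) ys!
          (λ ey ez y≉z → y≉z (slope-unique (i≢i′ ∘ A-injective i i′) ey ez)))))

    ∑-joins : ∀ {ys} → AllPairs (λ y z → ¬ (y ≈ z)) ys → ∑ ys joins ≤ n * q * (n * q)
    ∑-joins {ys} ys! = begin
      ∑ ys joins
        ≡⟨ trans (∑-swap ys points _) (∑-cong points (λ p → ∑-swap ys points _)) ⟩
      (∑[ p ← points ] ∑[ p′ ← points ] ∑[ y ← ys ] joined y p p′)
        ≤⟨ ∑-mono points (λ p → ∑-mono points (λ p′ → ∑-joined ys! p p′)) ⟩
      (∑[ p ← points ] ∑[ p′ ← points ] blockmates (proj₁ p) (proj₁ p′) * blockmates (proj₂ p) (proj₂ p′))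
        ≡⟨ ∑-cong points (λ p → trans (∑-cartesianProduct (allFin n) (allFin n) _) (sym (∑-product (allFin n) (allFin n) _ _))) ⟩
      (∑[ p ← points ] f (proj₁ p) * f (proj₂ p))
        ≡⟨ trans (∑-cartesianProduct (allFin n) (allFin n) _) (sym (∑-product (allFin n) (allFin n) _ _)) ⟩
      ∑ (allFin n) f * ∑ (allFin n) f
        ≤⟨ *-mono-≤ ∑-blockmates ∑-blockmates ⟩
      n * q * (n * q) ∎
      where
      open ≤-Reasoning
      f : Fin n → ℕ
      f i = ∑[ j ← allFin n ] blockmates i j

    top : ℕ
    top = n / q

    colours : List ℕ
    colours = downFrom (suc (2 * top))

    length-colours : length colours ≡ suc (2 * top)
    length-colours = length-downFrom (suc (2 * top))

    SameCell : Point → Point → Set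
    SameCell (i , j) (i′ , j′) = block i ≡ block i′ × block j ≡ block j′

    block≤top : ∀ i → block i ≤ top
    block≤top i = /-monoˡ-≤ q (rank≤n i)

    -- Along a line the cells met form a monotone staircase, so they are told apart by the sum
    -- of the two block coordinates, one of them reversed when the line is decreasing.
    record StaircaseColouring (y : Carrier) : Set where
      field
        colour    : Point → ℕ
        colour≤   : ∀ p → colour p ≤ 2 * top
        separates : ∀ p p′ → intercept y p ≈ intercept y p′ → colour p ≡ colour p′ → SameCell p p′

    same-abscissa : ∀ {y i j i′ j′} → A i ≈ A i′ → intercept y (i , j) ≈ intercept y (i′ , j′) → (i , j) ≡ (i′ , j′)
    same-abscissa {i = i} {j} {i′} {j′} i≈i′ eq with refl ← A-injective i i′ i≈i′ =
      cong (i ,_) (A-injective j j′ (intercept-injectiveˡ eq))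

    staircase⁺ : ∀ {y} → 0# ≺ y → StaircaseColouring y
    staircase⁺ {y} 0≺y = record { colour = col ; colour≤ = col≤ ; separates = sep }
      where
      col : Point → ℕ
      col (i , j) = block i + (top ∸ block j)
      col≤ : ∀ p → col p ≤ 2 * top
      col≤ (i , j) = +-mono-≤ (block≤top i) (≤-trans (m∸n≤m top (block j)) (≤-reflexive (sym (+-identityʳ top))))
      ascending : ∀ i j i′ j′ → intercept y (i , j) ≈ intercept y (i′ , j′) → A i ≺ A i′ →
                  col (i , j) ≡ col (i′ , j′) → SameCell (i , j) (i′ , j′)
      ascending i j i′ j′ eq i≺i′ col≡ with bi≡ , bj≡ ← +-≤-≡ (block-mono i≺i′)
                  (∸-monoʳ-≤ top (block-mono (intercept-decreasing 0≺y eq i≺i′))) col≡ =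
        -- Truncated subtraction from `top` may be cancelled because neither block exceeds `top`.
        bi≡ , ∸-cancelˡ-≡ (block≤top j) (block≤top j′) bj≡
      sep : ∀ p p′ → intercept y p ≈ intercept y p′ → col p ≡ col p′ → SameCell p p′
      sep (i , j) (i′ , j′) eq col≡ with compare (A i) (A i′)
      ... | tri< i≺i′ _ _ = ascending i j i′ j′ eq i≺i′ col≡
      ... | tri≈ _ i≈i′ _ with refl ← same-abscissa i≈i′ eq = refl , refl
      ... | tri> _ _ i′≺i with bi≡ , bj≡ ← ascending i′ j′ i j (≈-sym eq) i′≺i (sym col≡) = sym bi≡ , sym bj≡

    staircase⁻ : ∀ {y} → y ≺ 0# → StaircaseColouring y
    staircase⁻ {y} y≺0 = record { colour = col ; colour≤ = col≤ ; separates = sep }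
      where
      col : Point → ℕ
      col (i , j) = block i + block j
      col≤ : ∀ p → col p ≤ 2 * top
      col≤ (i , j) = +-mono-≤ (block≤top i) (≤-trans (block≤top j) (≤-reflexive (sym (+-identityʳ top))))
      sep : ∀ p p′ → intercept y p ≈ intercept y p′ → col p ≡ col p′ → SameCell p p′
      sep (i , j) (i′ , j′) eq col≡ with compare (A i) (A i′)
      ... | tri< i≺i′ _ _ = +-≤-≡ (block-mono i≺i′) (block-mono (intercept-increasing y≺0 eq i≺i′)) col≡
      ... | tri≈ _ i≈i′ _ with refl ← same-abscissa i≈i′ eq = refl , refl
      ... | tri> _ _ i′≺i with bi≡ , bj≡ ← +-≤-≡ (block-mono i′≺i) (block-mono (intercept-increasing y≺0 (≈-sym eq) i′≺i)) (sym col≡) =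
        sym bi≡ , sym bj≡

    staircase : ∀ {y} → ¬ (y ≈ 0#) → StaircaseColouring y
    staircase {y} y≉0 with compare y 0#
    ... | tri< y≺0 _ _ = staircase⁻ y≺0
    ... | tri≈ _ y≈0 _ = contradiction y≈0 y≉0
    ... | tri> _ _ 0≺y = staircase⁺ 0≺y

    module _ {y : Carrier} (y≉0 : ¬ (y ≈ 0#)) where

      open StaircaseColouring (staircase y≉0)

      joined-yes : ∀ p p′ → p ≢ p′ → intercept y p ≈ intercept y p′ → colour p ≡ colour p′ → 1 ≤ joined y p p′
      joined-yes (i , j) (i′ , j′) p≢p′ eq col≡ with bi≡ , bj≡ ← separates (i , j) (i′ , j′) eq col≡ =
        ≤-reflexive (sym (cong₂ _*_ (cong₂ _*_ (𝟙-yes (¬? (i Fin.≟ i′)) i≢i′) (𝟙-yes (block i ≟ block i′) bi≡))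
                          (cong₂ _*_ (cong₂ _*_ (𝟙-yes (¬? (j Fin.≟ j′)) j≢j′) (𝟙-yes (block j ≟ block j′) bj≡))
                                     (𝟙-yes (intercept y (i , j) ≟ᴿ intercept y (i′ , j′)) eq))))
        where
        open DecSetoid ≡-decSetoid using (_≟_)
        i≢i′ : i ≢ i′
        i≢i′ refl = p≢p′ (same-abscissa ≈-refl eq)
        j≢j′ : j ≢ j′
        j≢j′ refl = p≢p′ (same-abscissa (intercept-injectiveʳ y≉0 eq) eq)

      -- On a line the colour identifies the cell, so a pair of equal colour is either diagonal or a
      -- pair of distinct points in one cell.
      monochromatic≤ : ∀ p p′ → δ (intercept y p) (intercept y p′) * ℕ-Collisions.δ (colour p) (colour p′) ≤
                                𝟙 (p ≟ₚ p′) + joined y p p′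
      monochromatic≤ p p′ = 𝟙*-≤ (intercept y p ≟ᴿ intercept y p′) (λ eq → 𝟙-≤ (_ ≟ _) (λ col≡ → split eq col≡))
        where
        open DecSetoid ≡-decSetoid using (_≟_)
        split : intercept y p ≈ intercept y p′ → colour p ≡ colour p′ → 1 ≤ 𝟙 (p ≟ₚ p′) + joined y p p′
        split eq col≡ with p ≟ₚ p′
        ... | yes _    = s≤s z≤n
        ... | no p≢p′ = joined-yes p p′ p≢p′ eq col≡

      colour∈ : ∀ p → colour p ∈ˡ colours
      colour∈ p = ∈-downFrom⁺ (s≤s (colour≤ p))

      -- Cauchy-Schwarz over the cells that each line meets costs the factor `suc (2 * top)`; what
      -- remains are the n² diagonal pairs and the joined ones.
      energy≤ : energy y ≤ suc (2 * top) * (n * n + joins y)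
      energy≤ = begin
        energy y
          ≤⟨ collisions≤colours*monochromatic decSetoid ≡-decSetoid points (intercept y) colour (downFrom⁺ (suc (2 * top))) (λ {p} _ → colour∈ p) ⟩
        length colours * (∑[ p ← points ] ∑[ p′ ← points ] δ (intercept y p) (intercept y p′) * ℕ-Collisions.δ (colour p) (colour p′))
          ≤⟨ *-mono-≤ (≤-reflexive length-colours) (∑-mono points (λ p → ∑-mono points (monochromatic≤ p))) ⟩
        suc (2 * top) * (∑[ p ← points ] ∑[ p′ ← points ] (𝟙 (p ≟ₚ p′) + joined y p p′))
          ≡⟨ cong (suc (2 * top) *_) (trans (∑-cong points (λ p → ∑-+ points _ _)) (∑-+ points _ _)) ⟩
        suc (2 * top) * ((∑[ p ← points ] ∑[ p′ ← points ] 𝟙 (p ≟ₚ p′)) + joins y)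
          ≤⟨ *-monoʳ-≤ (suc (2 * top)) (+-monoˡ-≤ (joins y) (≤-trans (∑-bounded points ∑-diagonal)
               (≤-reflexive (trans (*-identityʳ _) length-points)))) ⟩
        suc (2 * top) * (n * n + joins y) ∎
        where open ≤-Reasoning

      richness : Carrier → ℕ
      richness t = ∑[ p ← points ] δ (intercept y p) t

      joinedOn : Carrier → ℕ
      joinedOn t = ∑[ p ← points ] ∑[ p′ ← points ] δ (intercept y p) t * δ (intercept y p′) t * joined y p p′

      -- A line with r points in at most k cells has at least r - k ordered pairs of distinct points
      -- in a common cell. The linear form keeps the cell count additive when lines are summed.
      richness≤ : ∀ t → richness t ≤ suc (2 * top) + joinedOn t
      richness≤ t = +-cancelˡ-≤ (richness t) _ _ (begin
        richness t + richness t
          ≡⟨ cong (richness t +_) (+-identityʳ (richness t)) ⟨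
        2 * richness t
          ≤⟨ ℕ-Collisions.fibre-linear points colour (downFrom⁺ (suc (2 * top))) u (λ {p} _ → colour∈ p) ⟩
        length colours + (∑[ p ← points ] ∑[ p′ ← points ] u p * u p′ * ℕ-Collisions.δ (colour p) (colour p′))
          ≤⟨ +-mono-≤ (≤-reflexive length-colours) (∑-mono points (λ p → ∑-mono points (λ p′ → pointwise p p′))) ⟩
        suc (2 * top) + (∑[ p ← points ] ∑[ p′ ← points ] (u p * 𝟙 (p ≟ₚ p′) + u p * u p′ * joined y p p′))
          ≡⟨ cong (suc (2 * top) +_) (trans (∑-cong points (λ p → ∑-+ points _ _)) (∑-+ points _ _)) ⟩
        suc (2 * top) + ((∑[ p ← points ] ∑[ p′ ← points ] u p * 𝟙 (p ≟ₚ p′)) + joinedOn t)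
          ≤⟨ +-monoʳ-≤ (suc (2 * top)) (+-monoˡ-≤ (joinedOn t) (∑-mono points (λ p →
               ≤-trans (≤-reflexive (∑-*ˡ points (u p) _)) (≤-trans (*-monoʳ-≤ (u p) (∑-diagonal p)) (≤-reflexive (*-identityʳ _)))))) ⟩
        suc (2 * top) + (richness t + joinedOn t)
          ≡⟨ shuffle (suc (2 * top)) (richness t) (joinedOn t) ⟩
        richness t + (suc (2 * top) + joinedOn t) ∎)
        where
        open ≤-Reasoning
        open DecSetoid ≡-decSetoid using (_≟_)
        u : Point → ℕ
        u p = δ (intercept y p) t
        shuffle : ∀ a b c → a + (b + c) ≡ b + (a + c)
        shuffle = solve-∀
        pointwise : ∀ p p′ → u p * u p′ * ℕ-Collisions.δ (colour p) (colour p′) ≤ u p * 𝟙 (p ≟ₚ p′) + u p * u p′ * joined y p p′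
        pointwise p p′ with intercept y p ≟ᴿ t | intercept y p′ ≟ᴿ t
        ... | no _      | _         = z≤n
        ... | yes _     | no _      = z≤n
        ... | yes p≈t   | yes p′≈t  = begin
          1 * ℕ-Collisions.δ (colour p) (colour p′)
            ≡⟨ cong (_* ℕ-Collisions.δ (colour p) (colour p′)) (𝟙-yes (intercept y p ≟ᴿ intercept y p′) p≈p′) ⟨
          δ (intercept y p) (intercept y p′) * ℕ-Collisions.δ (colour p) (colour p′)
            ≤⟨ monochromatic≤ p p′ ⟩
          𝟙 (p ≟ₚ p′) + joined y p p′
            ≡⟨ cong₂ _+_ (*-identityˡ (𝟙 (p ≟ₚ p′))) (*-identityˡ (joined y p p′)) ⟨
          1 * 𝟙 (p ≟ₚ p′) + 1 * joined y p p′                                             ∎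
          where p≈p′ = ≈-trans p≈t (≈-sym p′≈t)

      -- Injectivity of `t` makes the parallel lines distinct. A joined pair then lies on at most
      -- one of them, so `joins y` appears once and not n times.
      ∑-richness≤ : (t : Fin n → Carrier) → (∀ {a b} → t a ≈ t b → a ≡ b) →
                    (∑[ a ← allFin n ] richness (t a)) ≤ n * suc (2 * top) + joins y
      ∑-richness≤ t t-injective = begin
        (∑[ a ← allFin n ] richness (t a))
          ≤⟨ ∑-mono (allFin n) (richness≤ ∘ t) ⟩
        (∑[ a ← allFin n ] (suc (2 * top) + joinedOn (t a)))
          ≡⟨ ∑-+ (allFin n) _ _ ⟩
        (∑[ a ← allFin n ] suc (2 * top)) + (∑[ a ← allFin n ] joinedOn (t a))
          ≡⟨ cong₂ _+_ (trans (∑-const (allFin n) _) (cong (_* suc (2 * top)) (length-allFin n)))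
               (trans (∑-swap (allFin n) points _) (∑-cong points (λ p → ∑-swap (allFin n) points _))) ⟩
        n * suc (2 * top) + (∑[ p ← points ] ∑[ p′ ← points ] ∑[ a ← allFin n ] u p a * u p′ a * joined y p p′)
          ≤⟨ +-monoʳ-≤ (n * suc (2 * top)) (∑-mono points (λ p → ∑-mono points (λ p′ →
               ≤-trans (≤-reflexive (∑-*ʳ (allFin n) (joined y p p′) _)) (≤-trans (*-monoˡ-≤ (joined y p p′) (single p p′))
                 (≤-reflexive (*-identityˡ _)))))) ⟩
        n * suc (2 * top) + joins y ∎
        where
        open ≤-Reasoning
        u : Point → Fin n → ℕ
        u p a = δ (intercept y p) (t a)
        single : ∀ p p′ → (∑[ a ← allFin n ] u p a * u p′ a) ≤ 1
        single p p′ = ≤-trans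
          (∑-mono (allFin n) (λ a → ≤-trans (*-monoʳ-≤ (u p a) (𝟙≤1 (intercept y p′ ≟ᴿ t a))) (≤-reflexive (*-identityʳ _))))
          (∑-𝟙-unique (λ a → intercept y p ≟ᴿ t a) (λ e e′ → t-injective (≈-trans (≈-sym e) e′)))

-- Dyadic summation over the slopes

∑-2^ : ∀ k → (∑[ i ← downFrom k ] 2 ^ i) ≤ 2 ^ k
∑-2^ zero    = z≤n
∑-2^ (suc k) = +-monoʳ-≤ (2 ^ k) (≤-trans (∑-2^ k) (≤-reflexive (sym (+-identityʳ _))))

cube : ℕ → ℕ
cube x = x * x * x

cube-double : ∀ x → cube (2 * x) ≡ 8 * cube x
cube-double = expand
  where
  expand : ∀ x → 2 * x * (2 * x) * (2 * x) ≡ 8 * (x * x * x)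
  expand = solve-∀

-- `I` is the last dyadic scale: a block of size `cube (2 ^ I)` still fits into `A`. When the number
-- grows by one, the exponent grows by at most one, since the old strict upper bound already gives
-- `suc (suc n) ≤ cube (2 ^ suc I)`.
⌊cubeRoot⌋₂ : ∀ n → 1 ≤ n → ∃ λ I → cube (2 ^ I) ≤ n × n < 8 * cube (2 ^ I)
⌊cubeRoot⌋₂ (suc zero)    _ = 0 , s≤s z≤n , s≤s (s≤s z≤n)
⌊cubeRoot⌋₂ (suc (suc n)) _ with ⌊cubeRoot⌋₂ (suc n) (s≤s z≤n)
... | I , low , high with cube (2 ^ suc I) ≤? suc (suc n)
...   | no ≰     = I , m≤n⇒m≤1+n low , <-≤-trans (≰⇒> ≰) (≤-reflexive (cube-double (2 ^ I)))
...   | yes cube≤ = suc I , cube≤ , (begin-strict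
  suc (suc n)           ≤⟨ high ⟩
  8 * cube (2 ^ I)      ≡⟨ cube-double (2 ^ I) ⟨
  cube (2 ^ suc I)      <⟨ m<m*n (cube (2 ^ suc I)) 8 {{cube≢0}} (s≤s (s≤s z≤n)) ⟩
  cube (2 ^ suc I) * 8  ≡⟨ *-comm (cube (2 ^ suc I)) 8 ⟩
  8 * cube (2 ^ suc I)  ∎)
  where
  open ≤-Reasoning
  cube≢0 : NonZero (cube (2 ^ suc I))
  cube≢0 = >-nonZero (subst (0 <_) (sym (cube-double (2 ^ I))) (≤-trans (s≤s z≤n) high))

-- The dyadic scale 2 ^ i is chosen so that E is about (n / 2 ^ i) ^ 3.
AtScale : ℕ → ℕ → ℕ → Set
AtScale N E i = 6 * N ≤ cube (2 ^ i) * E × cube (2 ^ i) * E ≤ 48 * N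

atScale? : ∀ N E i → Dec (AtScale N E i)
atScale? N E i = (6 * N ≤? cube (2 ^ i) * E) ×-dec (cube (2 ^ i) * E ≤? 48 * N)

-- The window from 6N to 48N has ratio 8, exactly the growth of `cube (2 ^ i)` when i increases by
-- one, so the product cannot jump over it. It starts below the upper end, and either enters the
-- window by scale `I` or is still below it there.
findScale : ∀ N E → E ≤ 48 * N → ∀ I → cube (2 ^ I) * E < 6 * N ⊎ ∃ λ i → i < suc I × AtScale N E i
findScale N E E≤ zero with 6 * N ≤? 1 * E
... | yes 6N≤ = inj₂ (0 , ≤-refl , 6N≤ , ≤-trans (≤-reflexive (*-identityˡ E)) E≤)
... | no  ≰   = inj₁ (≰⇒> ≰)
findScale N E E≤ (suc I) with findScale N E E≤ I
... | inj₂ (i , i<1+I , at) = inj₂ (i , m≤n⇒m≤1+n i<1+I , at)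
... | inj₁ small with 6 * N ≤? cube (2 ^ suc I) * E
...   | no  ≰   = inj₁ (≰⇒> ≰)
...   | yes 6N≤ = inj₂ (suc I , ≤-refl , 6N≤ , (begin
  cube (2 ^ suc I) * E      ≡⟨ cong (_* E) (cube-double (2 ^ I)) ⟩
  8 * cube (2 ^ I) * E      ≡⟨ *-assoc 8 (cube (2 ^ I)) E ⟩
  8 * (cube (2 ^ I) * E)    ≤⟨ *-monoʳ-≤ 8 (<⇒≤ small) ⟩
  8 * (6 * N)               ≡⟨ *-assoc 8 6 N ⟨
  48 * N                    ∎))
  where open ≤-Reasoning

-- The hypothesis `q ≤ n` absorbs the additional cell, turning 2n + q into 3n.
cells≤ : ∀ {n} q .{{_ : NonZero q}} → q ≤ n → q * suc (2 * (n / q)) ≤ 3 * n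
cells≤ {n} q q≤n = begin
  q * suc (2 * (n / q))    ≡⟨ expand q (n / q) ⟩
  q + 2 * (n / q * q)      ≤⟨ +-mono-≤ q≤n (*-monoʳ-≤ 2 (m/n*n≤m n q)) ⟩
  3 * n                    ∎
  where
  open ≤-Reasoning
  expand : ∀ q k → q * suc (2 * k) ≡ q + 2 * (k * q)
  expand = solve-∀

-- p = x ^ 2 balances the two summands once both are added up over the slopes.
combine : ∀ {n x R E J K} →
  x * x * R ≤ n * (3 * n) + x * x * K →
  x * x * x * E ≤ 3 * n * (n * n + J) →
  6 * cube n ≤ x * x * x * E → x * x * x * E ≤ 48 * cube n →
  x * x * (x * x * x) * (R * E) ≤ 18 * cube n * J + 48 * cube n * (x * x) * K
combine {n} {x} {R} {E} {J} {K} hR hE low high = begin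
  x * x * (x * x * x) * (R * E)            ≡⟨ regroup x R E ⟩
  x * x * R * F                            ≤⟨ *-monoˡ-≤ F hR ⟩
  (n * (3 * n) + x * x * K) * F            ≡⟨ *-distribʳ-+ F (n * (3 * n)) (x * x * K) ⟩
  -- The energy is estimated in two ways: by joined pairs where R is bounded by the cell count, and
  -- by the upper end of the scale where R is already bounded by joined pairs.
  n * (3 * n) * F + x * x * K * F          ≤⟨ +-mono-≤ (*-monoʳ-≤ (n * (3 * n)) F≤6nJ) (*-monoʳ-≤ (x * x * K) high) ⟩
  n * (3 * n) * (6 * n * J) + x * x * K * (48 * (n * n * n)) ≡⟨ collect n x J K ⟩
  18 * cube n * J + 48 * cube n * (x * x) * K ∎
  where
  open ≤-Reasoning
  F : ℕ
  F = x * x * x * E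
  regroup : ∀ x R E → x * x * (x * x * x) * (R * E) ≡ x * x * R * (x * x * x * E)
  regroup = solve-∀
  collect : ∀ n x J K → n * (3 * n) * (6 * n * J) + x * x * K * (48 * (n * n * n)) ≡
                        18 * (n * n * n) * J + 48 * (n * n * n) * (x * x) * K
  collect = solve-∀
  double : ∀ n J → 2 * (3 * n * (n * n + J)) ≡ 6 * (n * n * n) + 6 * n * J
  double = solve-∀
  -- This is the origin of the 6 in `low`: the cell-count term of `hE` is 3n³, hence at most half of
  -- F, and doubling lets F absorb it.
  F≤6nJ : F ≤ 6 * n * J
  F≤6nJ = +-cancelˡ-≤ F F (6 * n * J) (begin
    F + F                          ≡⟨ cong (F +_) (+-identityʳ F) ⟨
    2 * F                          ≤⟨ *-monoʳ-≤ 2 hE ⟩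
    2 * (3 * n * (n * n + J))      ≡⟨ double n J ⟩
    6 * cube n + 6 * n * J         ≤⟨ +-monoˡ-≤ (6 * n * J) low ⟩
    F + 6 * n * J                  ∎)

-- Incidences weighted by energy

module Slopes (ℝ : RealNumbers) (n : ℕ) (A : Fin n → RealNumbers.Carrier ℝ) (A-injective : IsFiniteSet ℝ n A) where

  open OrderedField ℝ
  open Grid ℝ n A A-injective

  -- Each point pairs a variable from one side of the equation with one from the other side, which
  -- is the arrangement that `intercept-negate` expects.
  quadruples : Carrier → ℕ
  quadruples y = ∑[ p ← points ] ∑[ q ← points ]
    𝟙 (((A (proj₂ p) ⊕ A (proj₂ q)) ⊕ y ⊗ (A (proj₁ p) ⊕ A (proj₁ q))) ≟ᴿ 0#)

  -- With d = d′ allowed, a triple satisfying A d = - A a would be incident for every slope, and no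
  -- bound over all slopes would hold.
  incidence : Carrier → Fin n → Fin n → Fin n → ℕ
  incidence y a d d′ = 𝟙 (¬? (d Fin.≟ d′)) * 𝟙 (((A d ⊕ A a) ⊕ y ⊗ (A d′ ⊕ A a)) ≟ᴿ 0#)

  incidences : Carrier → ℕ
  incidences y = ∑[ a ← allFin n ] ∑[ d ← allFin n ] ∑[ d′ ← allFin n ] incidence y a d d′

  -- The quadruples are mixed collisions of φ_y with its negative, and negation preserves the number
  -- of collisions.
  quadruples≤energy : ∀ y → quadruples y ≤ energy y
  quadruples≤energy y = *-cancelˡ-≤ 2 (begin
    2 * quadruples y
      ≤⟨ *-monoʳ-≤ 2 (∑-mono points (λ p → ∑-mono points (λ q → 𝟙-mono (_ ≟ᴿ _) (intercept y p ≟ᴿ ⊖ (intercept y q)) intercept-negate))) ⟩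
    2 * collisions points (intercept y) points (⊖_ ∘ intercept y)
      ≤⟨ collisions-amGm points (intercept y) points (⊖_ ∘ intercept y) ⟩
    energy y + collisions points (⊖_ ∘ intercept y) points (⊖_ ∘ intercept y)
      ≤⟨ +-monoʳ-≤ (energy y) (∑-mono points (λ p → ∑-mono points (λ q → δ-cong {⊖ (intercept y p)} {⊖ (intercept y q)} ⊖-injective))) ⟩
    energy y + energy y
      ≡⟨ cong (energy y +_) (+-identityʳ (energy y)) ⟨
    2 * energy y ∎)
    where open ≤-Reasoning

  ∑-allFin≤ : ∀ {f : Fin n → ℕ} {c} → (∀ i → f i ≤ c) → ∑ (allFin n) f ≤ n * c
  ∑-allFin≤ {c = c} h = ≤-trans (∑-bounded (allFin n) h) (≤-reflexive (cong (_* c) (length-allFin n)))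

  ∑-points≤ : ∀ {f : Point → ℕ} {c} → (∀ p → f p ≤ c) → ∑ points f ≤ n * n * c
  ∑-points≤ {c = c} h = ≤-trans (∑-bounded points h) (≤-reflexive (cong (_* c) length-points))

  ∑-points-unique≤ : ∀ {P : Point → Set} (P? : ∀ p → Dec (P p)) → (∀ {i j j′} → P (i , j) → P (i , j′) → j ≡ j′) →
                     (∑[ p ← points ] 𝟙 (P? p)) ≤ n
  ∑-points-unique≤ P? unique = ≤-trans (≤-reflexive (∑-cartesianProduct (allFin n) (allFin n) _))
    (≤-trans (∑-allFin≤ (λ i → ∑-𝟙-unique (λ j → P? (i , j)) unique)) (≤-reflexive (*-identityʳ n)))

  energy≤cube : ∀ y → energy y ≤ cube n
  energy≤cube y = ∑-points≤ (λ p → ∑-points-unique≤ (λ q → intercept y p ≟ᴿ intercept y q)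
    (λ {i} {j} {j′} e e′ → A-injective j j′ (intercept-injectiveˡ (≈-trans (≈-sym e) e′))))

  ∑-incidence≤1 : ∀ {ys} → AllPairs (λ y z → ¬ (y ≈ z)) ys → ∀ a d d′ → (∑[ y ← ys ] incidence y a d d′) ≤ 1
  ∑-incidence≤1 {ys} ys! a d d′ = ≤-trans (≤-reflexive (∑-*ˡ ys (𝟙 (¬? (d Fin.≟ d′))) _)) (𝟙*-≤ (¬? (d Fin.≟ d′)) (λ d≢d′ →
    ∑-𝟙≤1 (λ y → ((A d ⊕ A a) ⊕ y ⊗ (A d′ ⊕ A a)) ≟ᴿ 0#) ys! (λ hy hz y≉z → y≉z (root-unique (denominator d≢d′ hy) hy hz))))
    where
    -- If the denominator vanished, the equation would make the numerator vanish as well, forcing d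
    -- = d′.
    denominator : ∀ {y} → d ≢ d′ → (A d ⊕ A a) ⊕ y ⊗ (A d′ ⊕ A a) ≈ 0# → ¬ (A d′ ⊕ A a ≈ 0#)
    denominator d≢d′ h d′+a≈0 = d≢d′ (A-injective d d′ (⊕-cancelʳ (A a) _ _ (≈-trans (root-of-zero h d′+a≈0) (≈-sym d′+a≈0))))

  ∑-incidences≤ : ∀ {ys} → AllPairs (λ y z → ¬ (y ≈ z)) ys → ∑ ys incidences ≤ cube n
  ∑-incidences≤ {ys} ys! = begin
    ∑ ys incidences
      ≡⟨ ∑-swap ys (allFin n) _ ⟩
    (∑[ a ← allFin n ] ∑[ y ← ys ] ∑[ d ← allFin n ] ∑[ d′ ← allFin n ] incidence y a d d′)
      ≡⟨ ∑-cong (allFin n) (λ a → trans (∑-swap ys (allFin n) _) (∑-cong (allFin n) (λ d → ∑-swap ys (allFin n) _))) ⟩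
    (∑[ a ← allFin n ] ∑[ d ← allFin n ] ∑[ d′ ← allFin n ] ∑[ y ← ys ] incidence y a d d′)
      ≤⟨ ∑-allFin≤ (λ a → ∑-allFin≤ (λ d → ∑-allFin≤ (λ d′ → ∑-incidence≤1 ys! a d d′))) ⟩
    n * (n * (n * 1))
      ≡⟨ expand n ⟩
    cube n ∎
    where
    open ≤-Reasoning
    expand : ∀ n → n * (n * (n * 1)) ≡ n * n * n
    expand = solve-∀

  module _ {y : Carrier} (y≉0 : ¬ (y ≈ 0#)) (1+y≉0 : ¬ (1# ⊕ y ≈ 0#)) where

    -- The incidences with `a` fixed lie on the line at height - (1 + y) a; since 1 + y ≠ 0, these n
    -- lines are distinct and can be summed together.
    incidences≤ : ∀ p .{{_ : NonZero p}} → incidences y ≤ n * suc (2 * (n / p)) + Blocks.joins p y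
    incidences≤ p = ≤-trans (∑-mono (allFin n) atTranslate)
      (Blocks.∑-richness≤ p y≉0 t (λ {a} {b} e → A-injective a b (translate-injective 1+y≉0 e)))
      where
      open ≤-Reasoning
      t : Fin n → Carrier
      t a = ⊖ ((1# ⊕ y) ⊗ A a)
      atTranslate : ∀ a → (∑[ d ← allFin n ] ∑[ d′ ← allFin n ] incidence y a d d′) ≤ Blocks.richness p y≉0 (t a)
      atTranslate a = begin
        (∑[ d ← allFin n ] ∑[ d′ ← allFin n ] incidence y a d d′)
          ≤⟨ ∑-mono (allFin n) (λ d → ∑-mono (allFin n) (λ d′ →
               𝟙*-≤ (¬? (d Fin.≟ d′)) (λ _ → 𝟙-mono (_ ≟ᴿ _) (intercept y (d′ , d) ≟ᴿ t a) intercept-translate))) ⟩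
        (∑[ d ← allFin n ] ∑[ d′ ← allFin n ] δ (intercept y (d′ , d)) (t a))
          ≡⟨ ∑-swap (allFin n) (allFin n) _ ⟩
        (∑[ d′ ← allFin n ] ∑[ d ← allFin n ] δ (intercept y (d′ , d)) (t a))
          ≡⟨ ∑-cartesianProduct (allFin n) (allFin n) _ ⟨
        Blocks.richness p y≉0 (t a) ∎

    incidences*energy≤ : ∀ x .{{_ : NonZero (x * x)}} .{{_ : NonZero (x * x * x)}} → x * x ≤ n → x * x * x ≤ n →
      6 * cube n ≤ x * x * x * energy y → x * x * x * energy y ≤ 48 * cube n →
      x * x * (x * x * x) * (incidences y * energy y) ≤
      18 * cube n * Blocks.joins (x * x * x) y + 48 * cube n * (x * x) * Blocks.joins (x * x) y
    incidences*energy≤ x p≤n q≤n = combine {n} {x} {incidences y} {energy y} hR hE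
      where
      open ≤-Reasoning
      p q : ℕ
      p = x * x
      q = x * x * x
      swap : ∀ p n c k → p * (n * c + k) ≡ n * (p * c) + p * k
      swap = solve-∀
      hR : p * incidences y ≤ n * (3 * n) + p * Blocks.joins p y
      hR = begin
        p * incidences y                                              ≤⟨ *-monoʳ-≤ p (incidences≤ p) ⟩
        p * (n * suc (2 * (n / p)) + Blocks.joins p y)                ≡⟨ swap p n (suc (2 * (n / p))) (Blocks.joins p y) ⟩
        n * (p * suc (2 * (n / p))) + p * Blocks.joins p y            ≤⟨ +-monoˡ-≤ _ (*-monoʳ-≤ n (cells≤ p p≤n)) ⟩
        n * (3 * n) + p * Blocks.joins p y                            ∎
      hE : q * energy y ≤ 3 * n * (n * n + Blocks.joins q y)
      hE = begin
        q * energy y                                                  ≤⟨ *-monoʳ-≤ q (Blocks.energy≤ q y≉0) ⟩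
        q * (suc (2 * (n / q)) * (n * n + Blocks.joins q y))          ≡⟨ *-assoc q (suc (2 * (n / q))) _ ⟨
        q * suc (2 * (n / q)) * (n * n + Blocks.joins q y)            ≤⟨ *-monoˡ-≤ _ (cells≤ q q≤n) ⟩
        3 * n * (n * n + Blocks.joins q y)                            ∎

  Admissible : Carrier → Set
  Admissible y = ¬ (y ≈ 0#) × ¬ (1# ⊕ y ≈ 0#)

  module _ {ys : List Carrier} (ys! : AllPairs (λ y z → ¬ (y ≈ z)) ys) (admissible : ∀ {y} → y ∈ˡ ys → Admissible y)
           {I : ℕ} (low : cube (2 ^ I) ≤ n) (high : n < 8 * cube (2 ^ I)) where

    private
      weight : ℕ → Carrier → ℕ
      weight i y = 𝟙 (atScale? (cube n) (energy y) i) * (incidences y * energy y)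

    ∑-weight≤ : ∀ {i} → i < suc I → ∑ ys (weight i) ≤ 66 * (n * n * cube n) * 2 ^ i
    ∑-weight≤ {i} (s≤s i≤I) = *-cancelˡ-≤ (x * x * q) {{pq≢0}} (begin
      x * x * q * ∑ ys (weight i)
        ≡⟨ ∑-*ˡ ys (x * x * q) _ ⟨
      (∑[ y ← ys ] x * x * q * weight i y)
        ≤⟨ ∑-mono-∈ ys (λ {y} y∈ys → pointwise y (admissible y∈ys)) ⟩
      (∑[ y ← ys ] (18 * cube n * Blocks.joins q {{q≢0}} y + 48 * cube n * (x * x) * Blocks.joins (x * x) {{p≢0}} y))
        ≡⟨ trans (∑-+ ys _ _) (cong₂ _+_ (∑-*ˡ ys (18 * cube n) _) (∑-*ˡ ys (48 * cube n * (x * x)) _)) ⟩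
      18 * cube n * ∑ ys (Blocks.joins q {{q≢0}}) + 48 * cube n * (x * x) * ∑ ys (Blocks.joins (x * x) {{p≢0}})
        ≤⟨ +-mono-≤ (*-monoʳ-≤ (18 * cube n) (Blocks.∑-joins q {{q≢0}} ys!)) (*-monoʳ-≤ (48 * cube n * (x * x)) (Blocks.∑-joins (x * x) {{p≢0}} ys!)) ⟩
      -- Both terms are multiples of n⁵ x⁶, with 18 + 48 = 66; cancelling the factor x⁵ leaves a
      -- single x.
      18 * cube n * (n * q * (n * q)) + 48 * cube n * (x * x) * (n * (x * x) * (n * (x * x)))
        ≡⟨ collect (cube n) n x ⟩
      x * x * q * (66 * (n * n * cube n) * x) ∎)
      where
      open ≤-Reasoning
      x q : ℕ
      x = 2 ^ i
      q = x * x * x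
      p≢0 : NonZero (x * x)
      p≢0 = m*n≢0 x x {{m^n≢0 2 i}} {{m^n≢0 2 i}}
      q≢0 : NonZero q
      q≢0 = m*n≢0 (x * x) x {{p≢0}} {{m^n≢0 2 i}}
      pq≢0 : NonZero (x * x * q)
      pq≢0 = m*n≢0 (x * x) q {{p≢0}} {{q≢0}}
      q≤n : q ≤ n
      q≤n = ≤-trans (*-mono-≤ (*-mono-≤ x≤ x≤) x≤) low
        where x≤ = ^-monoʳ-≤ 2 i≤I
      p≤n : x * x ≤ n
      p≤n = ≤-trans (m≤m*n (x * x) x {{m^n≢0 2 i}}) q≤n
      collect : ∀ N n x → 18 * N * (n * (x * x * x) * (n * (x * x * x))) + 48 * N * (x * x) * (n * (x * x) * (n * (x * x))) ≡
                          x * x * (x * x * x) * (66 * (n * n * N) * x)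
      collect = solve-∀
      pull : ∀ k b c → k * (b * c) ≡ b * (k * c)
      pull = solve-∀
      pointwise : ∀ y → Admissible y → x * x * q * weight i y ≤
        18 * cube n * Blocks.joins q {{q≢0}} y + 48 * cube n * (x * x) * Blocks.joins (x * x) {{p≢0}} y
      pointwise y (y≉0 , 1+y≉0) = ≤-trans
        (≤-reflexive (pull (x * x * q) (𝟙 (atScale? (cube n) (energy y) i)) (incidences y * energy y)))
        (𝟙*-≤ (atScale? (cube n) (energy y) i) (λ (lo , hi) → incidences*energy≤ y≉0 1+y≉0 x {{p≢0}} {{q≢0}} p≤n q≤n lo hi))

    incidences*quadruples≤ : .{{_ : NonZero n}} → ∀ y →
      incidences y * quadruples y ≤ 48 * (n * n) * incidences y + (∑[ i ← downFrom (suc I) ] weight i y)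
    incidences*quadruples≤ y = ≤-trans (*-monoʳ-≤ (incidences y) (quadruples≤energy y)) split
      where
      open ≤-Reasoning
      E : ℕ
      E = energy y
      E≤ : E ≤ 48 * cube n
      E≤ = ≤-trans (energy≤cube y) (m≤n*m (cube n) 48)
      split : incidences y * E ≤ 48 * (n * n) * incidences y + (∑[ i ← downFrom (suc I) ] weight i y)
      split with findScale (cube n) E E≤ I
      ... | inj₂ (i , i<1+I , at) = ≤-trans
        (≤-reflexive (sym (trans (cong (_* (incidences y * E)) (𝟙-yes (atScale? (cube n) E i) at)) (*-identityˡ _))))
        (≤-trans (∑-member (λ i → weight i y) (∈-downFrom⁺ i<1+I)) (m≤n+m _ (48 * (n * n) * incidences y)))
      -- Below the last scale, n < 8 `cube (2 ^ I)` forces E ≤ 48 n², so these slopes are covered by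
      -- a multiple of their incidences alone.
      ... | inj₁ small = ≤-trans (≤-reflexive (*-comm (incidences y) E))
        (≤-trans (*-monoˡ-≤ (incidences y) (*-cancelˡ-≤ n (begin
          n * E                       ≤⟨ *-monoˡ-≤ E (<⇒≤ high) ⟩
          8 * cube (2 ^ I) * E        ≡⟨ *-assoc 8 (cube (2 ^ I)) E ⟩
          8 * (cube (2 ^ I) * E)      ≤⟨ *-monoʳ-≤ 8 (<⇒≤ small) ⟩
          8 * (6 * cube n)            ≡⟨ regroup n ⟩
          n * (48 * (n * n))          ∎))) (m≤m+n (48 * (n * n) * incidences y) _))
        where
        regroup : ∀ n → 8 * (6 * (n * n * n)) ≡ n * (48 * (n * n))
        regroup = solve-∀

    -- The powers of two up to `2 ^ I` sum to at most twice the last one. The constant is 48 from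
    -- the low energies, absorbed by 1 ≤ `2 ^ I`, plus 2 * 66 from the scales.
    ∑-incidences*quadruples≤ : .{{_ : NonZero n}} →
      (∑[ y ← ys ] incidences y * quadruples y) ≤ 180 * (n * n * cube n) * 2 ^ I
    ∑-incidences*quadruples≤ = begin
      (∑[ y ← ys ] incidences y * quadruples y)
        ≤⟨ ∑-mono ys incidences*quadruples≤ ⟩
      (∑[ y ← ys ] (48 * (n * n) * incidences y + (∑[ i ← downFrom (suc I) ] weight i y)))
        ≡⟨ trans (∑-+ ys _ _) (cong₂ _+_ (∑-*ˡ ys (48 * (n * n)) _) (∑-swap ys (downFrom (suc I)) _)) ⟩
      48 * (n * n) * ∑ ys incidences + (∑[ i ← downFrom (suc I) ] ∑ ys (weight i))
        ≤⟨ +-mono-≤ (*-monoʳ-≤ (48 * (n * n)) (∑-incidences≤ ys!)) (∑-mono-∈ (downFrom (suc I)) (λ i∈ → ∑-weight≤ (∈-downFrom⁻ i∈))) ⟩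
      48 * (n * n) * cube n + (∑[ i ← downFrom (suc I) ] 66 * (n * n * cube n) * 2 ^ i)
        ≡⟨ cong (48 * (n * n) * cube n +_) (∑-*ˡ (downFrom (suc I)) (66 * (n * n * cube n)) _) ⟩
      48 * (n * n) * cube n + 66 * (n * n * cube n) * (∑[ i ← downFrom (suc I) ] 2 ^ i)
        ≤⟨ +-mono-≤ (m≤m*n (48 * (n * n) * cube n) (2 ^ I) {{m^n≢0 2 I}}) (*-monoʳ-≤ (66 * (n * n * cube n)) (∑-2^ (suc I))) ⟩
      48 * (n * n) * cube n * 2 ^ I + 66 * (n * n * cube n) * (2 * 2 ^ I)
        ≡⟨ collect (n * n) (cube n) (2 ^ I) ⟩
      180 * (n * n * cube n) * 2 ^ I ∎
      where
      open ≤-Reasoning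
      collect : ∀ N M x → 48 * N * M * x + 66 * (N * M) * (2 * x) ≡ 180 * (N * M) * x
      collect = solve-∀

-- Averaging, and from collisions to cardinality

lookup-separated : {X : Set} {_≈_ : X → X → Set} → Symmetric _≈_ → {xs : List X} → AllPairs (λ x y → ¬ (x ≈ y)) xs →
                   ∀ i j → lookup xs i ≈ lookup xs j → i ≡ j
lookup-separated ≈-sym (x# ∷ xs!) zero    zero    eq = refl
lookup-separated ≈-sym (x# ∷ xs!) zero    (suc j) eq = contradiction eq (All.lookup x# (∈-lookup j))
lookup-separated ≈-sym (x# ∷ xs!) (suc i) zero    eq = contradiction (≈-sym eq) (All.lookup x# (∈-lookup i))
lookup-separated ≈-sym (x# ∷ xs!) (suc i) (suc j) eq = cong suc (lookup-separated ≈-sym xs! i j eq)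

subset : ∀ {n} {P : Fin n → Set} → (∀ i → Dec (P i)) → Subset n
subset P? = Vec.tabulate (does ∘ P?)

∈-subset⁻ : ∀ {n} {P : Fin n → Set} (P? : ∀ i → Dec (P i)) {i} → i ∈ subset P? → P i
∈-subset⁻ P? {i} i∈ with P? i | trans (sym (lookup∘tabulate (does ∘ P?) i)) ([]=⇒lookup i∈)
... | yes p | _  = p
... | no  _ | ()

∣subset∣ : ∀ {n} {P : Fin n → Set} (P? : ∀ i → Dec (P i)) → ∣ subset P? ∣ ≡ (∑[ i ← allFin n ] 𝟙 (P? i))
∣subset∣ P? = count P? id
  where
  count : ∀ {n} {X : Set} {P : X → Set} (P? : ∀ x → Dec (P x)) (g : Fin n → X) →
          ∣ subset (P? ∘ g) ∣ ≡ (∑[ x ← tabulate g ] 𝟙 (P? x))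
  count {zero}  P? g = refl
  count {suc n} P? g with P? (g zero)
  ... | yes _ = cong suc (count P? (g ∘ suc))
  ... | no  _ = count P? (g ∘ suc)

-- Each index above the threshold contributes at least `T`, so twice their number is at most n;
-- adding the complement counts every index twice.
markov : ∀ {n} (f : Fin n → ℕ) (T : ℕ) .{{_ : NonZero T}} → 2 * ∑ (allFin n) f ≤ n * T →
         n ≤ 2 * ∣ subset (λ i → f i ≤? T) ∣
markov {n} f T 2∑f≤nT = +-cancelˡ-≤ n n _ (begin
  n + n                ≡⟨ cong₂ _+_ n≡ n≡ ⟩
  g + h + (g + h)      ≡⟨ regroup g h ⟩
  2 * h + 2 * g        ≤⟨ +-mono-≤ 2h≤n (≤-reflexive (cong (2 *_) (sym (∣subset∣ (λ i → f i ≤? T))))) ⟩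
  n + 2 * ∣ subset (λ i → f i ≤? T) ∣ ∎)
  where
  open ≤-Reasoning
  g h : ℕ
  g = ∑[ i ← allFin n ] 𝟙 (f i ≤? T)
  h = ∑[ i ← allFin n ] 𝟙 (¬? (f i ≤? T))
  regroup : ∀ g h → g + h + (g + h) ≡ 2 * h + 2 * g
  regroup = solve-∀
  n≡ : n ≡ g + h
  n≡ = trans (sym (trans (∑-const (allFin n) 1) (trans (*-identityʳ _) (length-allFin n))))
             (trans (∑-cong (allFin n) (λ i → sym (𝟙-complement (f i ≤? T)))) (∑-+ (allFin n) _ _))
  hT≤∑f : h * T ≤ ∑ (allFin n) f
  hT≤∑f = ≤-trans (≤-reflexive (sym (∑-*ʳ (allFin n) T _)))
                  (∑-mono (allFin n) (λ i → 𝟙*-≤ (¬? (f i ≤? T)) (λ f≰T → <⇒≤ (≰⇒> f≰T))))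
  2h≤n : 2 * h ≤ n
  2h≤n = *-cancelʳ-≤ (2 * h) n T (≤-trans (≤-reflexive (*-assoc 2 h T)) (≤-trans (*-monoʳ-≤ 2 hT≤∑f) 2∑f≤nT))

size-bound : ∀ {n m N} K X .{{_ : NonZero (n * cube n)}} → n * (n * n) * (n * (n * n)) ≤ m * N → N ≤ K * (n * cube n) * X →
             n * n ≤ K * m * X
size-bound {n} {m} {N} K X cs N≤ = *-cancelʳ-≤ (n * n) (K * m * X) (n * (n * n * n)) (begin
  n * n * (n * (n * n * n))                  ≡⟨ regroupˡ n ⟩
  n * (n * n) * (n * (n * n))                ≤⟨ cs ⟩
  m * N                                      ≤⟨ *-monoʳ-≤ m N≤ ⟩
  m * (K * (n * (n * n * n)) * X)            ≡⟨ regroupʳ K X m (n * (n * n * n)) ⟩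
  K * m * X * (n * (n * n * n))              ∎)
  where
  open ≤-Reasoning
  regroupˡ : ∀ n → n * n * (n * (n * n * n)) ≡ n * (n * n) * (n * (n * n))
  regroupˡ = solve-∀
  regroupʳ : ∀ K X m M → m * (K * M * X) ≡ K * m * X * M
  regroupʳ = solve-∀

-- `X` stands for a dyadic cube root, so cubing replaces it by n and one factor n cancels from n⁶.
-- The factor `L` is inserted through `1 ≤ L`.
fifth-power-bound : ∀ {n m L} K X .{{_ : NonZero n}} → cube X ≤ n → n * n ≤ K * m * X → 1 ≤ L →
                    n ^ 5 ≤ cube K * (m ^ 3 * L)
fifth-power-bound {n} {m} {L} K X X³≤n n²≤ 1≤L = *-cancelʳ-≤ (n ^ 5) _ n (begin
  n ^ 5 * n                                 ≡⟨ regroupˡ n ⟩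
  cube (n * n)                              ≤⟨ *-mono-≤ (*-mono-≤ n²≤ n²≤) n²≤ ⟩
  cube (K * m * X)                          ≡⟨ regroupʳ K m X ⟩
  cube K * (m ^ 3 * 1) * cube X             ≤⟨ *-mono-≤ (*-monoʳ-≤ (cube K) (*-monoʳ-≤ (m ^ 3) 1≤L)) X³≤n ⟩
  cube K * (m ^ 3 * L) * n                  ∎)
  where
  open ≤-Reasoning
  regroupˡ : ∀ n → n * (n * (n * (n * (n * 1)))) * n ≡ n * n * (n * n) * (n * n)
  regroupˡ = solve-∀
  regroupʳ : ∀ K m X → K * m * X * (K * m * X) * (K * m * X) ≡ K * K * K * (m * (m * (m * 1)) * 1) * (X * X * X)
  regroupʳ = solve-∀

-- Counting collisions of products

module Products (ℝ : RealNumbers) (n : ℕ) (A : Fin n → RealNumbers.Carrier ℝ) (A-injective : IsFiniteSet ℝ n A) where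

  open OrderedField ℝ
  open Grid ℝ n A A-injective
  open Slopes ℝ n A A-injective

  Triple : Set
  Triple = Fin n × Fin n × Fin n

  triples : List Triple
  triples = cartesianProduct (allFin n) points

  length-triples : length triples ≡ n * (n * n)
  length-triples = trans (length-cartesianProduct (allFin n) points) (cong₂ _*_ (length-allFin n) length-points)

  ∑-points : (f : Point → ℕ) → ∑ points f ≡ (∑[ i ← allFin n ] ∑[ j ← allFin n ] f (i , j))
  ∑-points = ∑-cartesianProduct (allFin n) (allFin n)

  -- Bringing `d` to the front groups the collisions by the pair (d , d′), which together with `a`
  -- fixes the slope.
  ∑-triples : (f : Triple → ℕ) → ∑ triples f ≡ (∑[ d ← allFin n ] ∑[ s ← points ] f (proj₁ s , proj₂ s , d))
  ∑-triples f = begin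
    ∑ triples f
      ≡⟨ ∑-cartesianProduct (allFin n) points f ⟩
    (∑[ b ← allFin n ] ∑[ cd ← points ] f (b , cd))
      ≡⟨ ∑-cong (allFin n) (λ b → trans (∑-points _) (∑-swap (allFin n) (allFin n) _)) ⟩
    (∑[ b ← allFin n ] ∑[ d ← allFin n ] ∑[ c ← allFin n ] f (b , c , d))
      ≡⟨ ∑-swap (allFin n) (allFin n) _ ⟩
    (∑[ d ← allFin n ] ∑[ b ← allFin n ] ∑[ c ← allFin n ] f (b , c , d))
      ≡⟨ ∑-cong (allFin n) (λ d → ∑-points _) ⟨
    (∑[ d ← allFin n ] ∑[ s ← points ] f (proj₁ s , proj₂ s , d)) ∎
    where open ≡-Reasoning

  -- Products come with the sums b + c and b′ + c′, whereas the energy concerns the points (b , b′)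
  -- and (c , c′); this passes from one grouping to the other.
  ∑-points-transpose : (f : Fin n → Fin n → Fin n → Fin n → ℕ) →
    (∑[ s ← points ] ∑[ t ← points ] f (proj₁ s) (proj₂ s) (proj₁ t) (proj₂ t)) ≡
    (∑[ p ← points ] ∑[ q ← points ] f (proj₁ p) (proj₁ q) (proj₂ p) (proj₂ q))
  ∑-points-transpose f = begin
    (∑[ s ← points ] ∑[ t ← points ] f (proj₁ s) (proj₂ s) (proj₁ t) (proj₂ t))
      ≡⟨ trans (∑-points _) (∑-cong (allFin n) (λ b → ∑-cong (allFin n) (λ c → ∑-points _))) ⟩
    (∑[ b ← allFin n ] ∑[ c ← allFin n ] ∑[ b′ ← allFin n ] ∑[ c′ ← allFin n ] f b c b′ c′)
      ≡⟨ ∑-cong (allFin n) (λ b → ∑-swap (allFin n) (allFin n) _) ⟩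
    (∑[ b ← allFin n ] ∑[ b′ ← allFin n ] ∑[ c ← allFin n ] ∑[ c′ ← allFin n ] f b c b′ c′)
      ≡⟨ trans (∑-points _) (∑-cong (allFin n) (λ b → ∑-cong (allFin n) (λ b′ → ∑-points _))) ⟨
    (∑[ p ← points ] ∑[ q ← points ] f (proj₁ p) (proj₁ q) (proj₂ p) (proj₂ q)) ∎
    where open ≡-Reasoning

  pairSum : Point → Carrier
  pairSum (b , c) = A b ⊕ A c

  product : Fin n → Triple → Carrier
  product a = prodElt ℝ A (A a)

  productCollisions : Fin n → ℕ
  productCollisions a = collisions triples (product a) triples (product a)

  slice : Fin n → Fin n → Fin n → ℕ
  slice a d d′ = ∑[ s ← points ] ∑[ t ← points ] δ (pairSum s ⊗ (A d ⊕ A a)) (pairSum t ⊗ (A d′ ⊕ A a))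

  productCollisions≡ : ∀ a → productCollisions a ≡ (∑[ d ← allFin n ] ∑[ d′ ← allFin n ] slice a d d′)
  productCollisions≡ a = trans (∑-triples _) (∑-cong (allFin n) (λ d →
    trans (∑-cong points (λ s → ∑-triples _)) (∑-swap points (allFin n) _)))

  slice≤ : ∀ a d d′ → slice a d d′ ≤ n * cube n
  slice≤ a d d′ = ≤-trans
    (∑-points≤ (λ s → ∑-points≤ (λ t → 𝟙≤1 (pairSum s ⊗ (A d ⊕ A a) ≟ᴿ pairSum t ⊗ (A d′ ⊕ A a)))))
    (≤-reflexive (expand n))
    where
    expand : ∀ n → n * n * (n * n * 1) ≡ n * (n * n * n)
    expand = solve-∀

  pairSum-cancel : ∀ {i j j′ v w} → ¬ (v ≈ 0#) → pairSum (i , j) ⊗ v ≈ w → pairSum (i , j′) ⊗ v ≈ w → j ≡ j′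
  pairSum-cancel {i} {j} {j′} v≉0 e e′ = A-injective j j′ (⊕-cancelˡ (A i) _ _ (⊗-cancelʳ _ v≉0 (≈-trans e (≈-sym e′))))

  -- One nonzero factor suffices: once `t` and the first summand of `s` are fixed, cancelling that
  -- factor determines the second summand.
  slice≤ˡ : ∀ a d d′ → ¬ (A d ⊕ A a ≈ 0#) → slice a d d′ ≤ cube n
  slice≤ˡ a d d′ d+a≉0 = ≤-trans (≤-reflexive (∑-swap points points _))
    (∑-points≤ (λ t → ∑-points-unique≤ (λ s → pairSum s ⊗ (A d ⊕ A a) ≟ᴿ pairSum t ⊗ (A d′ ⊕ A a)) (pairSum-cancel d+a≉0)))

  slice≤ʳ : ∀ a d d′ → ¬ (A d′ ⊕ A a ≈ 0#) → slice a d d′ ≤ cube n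
  slice≤ʳ a d d′ d′+a≉0 = ∑-points≤ (λ s → ∑-points-unique≤ (λ t → pairSum s ⊗ (A d ⊕ A a) ≟ᴿ pairSum t ⊗ (A d′ ⊕ A a))
    (λ e e′ → pairSum-cancel d′+a≉0 (≈-sym e) (≈-sym e′)))

  slice≤quadruples : ∀ {y} a d d′ → ¬ (A d′ ⊕ A a ≈ 0#) → (A d ⊕ A a) ⊕ y ⊗ (A d′ ⊕ A a) ≈ 0# → slice a d d′ ≤ quadruples y
  slice≤quadruples {y} a d d′ d′+a≉0 h = ≤-trans
    (∑-mono points (λ s → ∑-mono points (λ t →
      𝟙-mono (pairSum s ⊗ (A d ⊕ A a) ≟ᴿ pairSum t ⊗ (A d′ ⊕ A a)) (pairSum t ⊕ y ⊗ pairSum s ≟ᴿ 0#) (root-transfer d′+a≉0 h))))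
    (≤-reflexive (∑-points-transpose (λ b c b′ c′ → 𝟙 ((A b′ ⊕ A c′) ⊕ y ⊗ (A b ⊕ A c) ≟ᴿ 0#))))

  slope : Triple → Carrier
  slope (a , d , d′) = proj₁ (root (A d ⊕ A a) (A d′ ⊕ A a))

  admissible? : ∀ y → Dec (Admissible y)
  admissible? y = ¬? (y ≟ᴿ 0#) ×-dec ¬? (1# ⊕ y ≟ᴿ 0#)

  -- One representative for each slope that occurs, so that different entries are inequivalent and
  -- the bounds over all slopes apply.
  slopes : List Carrier
  slopes = filter admissible? (values triples slope)

  slopes! : AllPairs (λ y z → ¬ (y ≈ z)) slopes
  slopes! = filter⁺ admissible? (values! triples slope)

  module _ (a d d′ : Fin n) where

    private
      u v : Carrier
      u = A d ⊕ A a
      v = A d′ ⊕ A a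

    slopeTerms : ℕ
    slopeTerms = ∑[ y ← slopes ] incidence y a d d′ * quadruples y

    -- A single term of the sum is kept, at the representative of the slope of (a , d , d′). The
    -- hypothesis on `v` makes it a genuine root, and those on `u` and on d ≠ d′ keep it away from 0
    -- and -1.
    slice≤slopeTerms : d ≢ d′ → ¬ (u ≈ 0#) → ¬ (v ≈ 0#) → slice a d d′ ≤ slopeTerms
    slice≤slopeTerms d≢d′ u≉0 v≉0 with find (∈-values triples slope
      (∈-cartesianProduct⁺ (∈-allFin a) (∈-cartesianProduct⁺ (∈-allFin d) (∈-allFin d′))))
    ... | y , y∈ , slope≈y = begin
      slice a d d′                          ≤⟨ slice≤quadruples a d d′ v≉0 hy ⟩
      quadruples y                          ≡⟨ *-identityˡ (quadruples y) ⟨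
      1 * quadruples y                      ≡⟨ cong (_* quadruples y) (cong₂ _*_ (𝟙-yes (¬? (d Fin.≟ d′)) d≢d′) (𝟙-yes (u ⊕ y ⊗ v ≟ᴿ 0#) hy)) ⟨
      incidence y a d d′ * quadruples y     ≤⟨ ∑-member (λ y → incidence y a d d′ * quadruples y) (∈-filter⁺ admissible? y∈ (root≉0 u≉0 hy , root≉-1 u≉v hy)) ⟩
      slopeTerms                            ∎
      where
      open ≤-Reasoning
      hy : u ⊕ y ⊗ v ≈ 0#
      hy = root-resp slope≈y (proj₂ (root u v) v≉0)
      u≉v : ¬ (u ≈ v)
      u≉v u≈v = d≢d′ (A-injective d d′ (⊕-cancelʳ (A a) _ _ u≈v))

    -- The first three terms stand for slope -1, slope 0 and a vanishing denominator, where a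
    -- nonzero factor still limits the slice to n³. If both factors vanish all n⁴ quadruples may
    -- occur, but only for one pair (d , d′), so each term adds up to at most n⁴.
    degenerate : ℕ
    degenerate = 𝟙 (d Fin.≟ d′) * cube n + (𝟙 (u ≟ᴿ 0#) * cube n + (𝟙 (v ≟ᴿ 0#) * cube n + 𝟙 (u ≟ᴿ 0#) * 𝟙 (v ≟ᴿ 0#) * (n * cube n)))

    slice-split : slice a d d′ ≤ degenerate + slopeTerms
    slice-split = split (d Fin.≟ d′) (u ≟ᴿ 0#) (v ≟ᴿ 0#)
      where
      split : (e? : Dec (d ≡ d′)) (u? : Dec (u ≈ 0#)) (v? : Dec (v ≈ 0#)) → slice a d d′ ≤
              𝟙 e? * cube n + (𝟙 u? * cube n + (𝟙 v? * cube n + 𝟙 u? * 𝟙 v? * (n * cube n))) + slopeTerms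
      split e? (yes _) (yes _) = ≤-trans (slice≤ a d d′) (≤-trans (≤-reflexive (sym (*-identityˡ (n * cube n))))
        (≤-trans (m≤n+m _ (1 * cube n)) (≤-trans (m≤n+m _ (1 * cube n)) (≤-trans (m≤n+m _ (𝟙 e? * cube n)) (m≤m+n _ slopeTerms)))))
      split e? (yes _) (no v≉0) = ≤-trans (slice≤ʳ a d d′ v≉0) (≤-trans (≤-reflexive (sym (*-identityˡ (cube n))))
        (≤-trans (m≤m+n (1 * cube n) _) (≤-trans (m≤n+m _ (𝟙 e? * cube n)) (m≤m+n _ slopeTerms))))
      split e? (no u≉0) (yes _) = ≤-trans (slice≤ˡ a d d′ u≉0) (≤-trans (≤-reflexive (sym (*-identityˡ (cube n))))
        (≤-trans (m≤m+n (1 * cube n) 0) (≤-trans (m≤n+m _ (𝟙 e? * cube n)) (m≤m+n _ slopeTerms))))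
      split (yes _) (no u≉0) (no _) = ≤-trans (slice≤ˡ a d d′ u≉0) (≤-trans (≤-reflexive (sym (*-identityˡ (cube n))))
        (≤-trans (m≤m+n (1 * cube n) 0) (m≤m+n _ slopeTerms)))
      split (no d≢d′) (no u≉0) (no v≉0) = slice≤slopeTerms d≢d′ u≉0 v≉0

  module _ (a : Fin n) where

    private
      zeros : Fin n → ℕ
      zeros d = 𝟙 (A d ⊕ A a ≟ᴿ 0#)

    ∑-zeros : ∑ (allFin n) zeros ≤ 1
    ∑-zeros = ∑-𝟙-unique (λ d → A d ⊕ A a ≟ᴿ 0#) (λ {d} {d′} h h′ → A-injective d d′ (⊕-cancelʳ (A a) _ _ (≈-trans h (≈-sym h′))))

    ∑-scaled≤ : ∀ {f : Fin n → ℕ} → ∑ (allFin n) f ≤ 1 → ∀ c → (∑[ d ← allFin n ] f d * c) ≤ c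
    ∑-scaled≤ h c = ≤-trans (≤-reflexive (∑-*ʳ (allFin n) c _)) (≤-trans (*-monoˡ-≤ c h) (≤-reflexive (*-identityˡ c)))

    ∑∑-+ : (f g : Fin n → Fin n → ℕ) → (∑[ d ← allFin n ] ∑[ d′ ← allFin n ] (f d d′ + g d d′)) ≡
           (∑[ d ← allFin n ] ∑[ d′ ← allFin n ] f d d′) + (∑[ d ← allFin n ] ∑[ d′ ← allFin n ] g d d′)
    ∑∑-+ f g = trans (∑-cong (allFin n) (λ d → ∑-+ (allFin n) (f d) (g d))) (∑-+ (allFin n) _ _)

    ∑-degenerate : (∑[ d ← allFin n ] ∑[ d′ ← allFin n ] degenerate a d d′) ≤ 4 * (n * cube n)
    ∑-degenerate = begin
      (∑[ d ← allFin n ] ∑[ d′ ← allFin n ] degenerate a d d′)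
        ≡⟨ trans (∑∑-+ _ _) (cong (diagonal +_) (trans (∑∑-+ _ _) (cong (left +_) (∑∑-+ _ _)))) ⟩
      diagonal + (left + (right + both))
        ≤⟨ +-mono-≤ diagonal≤ (+-mono-≤ left≤ (+-mono-≤ right≤ both≤)) ⟩
      n * N + (n * N + (n * N + n * N))
        ≡⟨ expand (n * N) ⟩
      4 * (n * N) ∎
      where
      open ≤-Reasoning
      N diagonal left right both : ℕ
      N = cube n
      diagonal = ∑[ d ← allFin n ] ∑[ d′ ← allFin n ] 𝟙 (d Fin.≟ d′) * N
      left     = ∑[ d ← allFin n ] ∑[ d′ ← allFin n ] zeros d * N
      right    = ∑[ d ← allFin n ] ∑[ d′ ← allFin n ] zeros d′ * N
      both     = ∑[ d ← allFin n ] ∑[ d′ ← allFin n ] zeros d * zeros d′ * (n * N)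
      diagonal≤ : diagonal ≤ n * N
      diagonal≤ = ∑-allFin≤ (λ d → ∑-scaled≤ (∑-𝟙-unique (d Fin.≟_) (λ e e′ → trans (sym e) e′)) N)
      right≤ : right ≤ n * N
      right≤ = ∑-allFin≤ (λ d → ∑-scaled≤ ∑-zeros N)
      left≤ : left ≤ n * N
      left≤ = ≤-trans (≤-reflexive (∑-swap (allFin n) (allFin n) (λ d _ → zeros d * N))) right≤
      both≤ : both ≤ n * N
      both≤ = ≤-trans
        (≤-reflexive (∑-cong (allFin n) (λ d → trans (∑-*ʳ (allFin n) (n * N) _) (cong (_* (n * N)) (∑-*ˡ (allFin n) (zeros d) zeros)))))
        (∑-scaled≤ (≤-trans (≤-reflexive (∑-*ʳ (allFin n) (∑ (allFin n) zeros) zeros)) (*-mono-≤ ∑-zeros ∑-zeros)) (n * N))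
      expand : ∀ k → k + (k + (k + k)) ≡ 4 * k
      expand = solve-∀

    productCollisions≤ : productCollisions a ≤ 4 * (n * cube n) + (∑[ d ← allFin n ] ∑[ d′ ← allFin n ] slopeTerms a d d′)
    productCollisions≤ = begin
      productCollisions a
        ≡⟨ productCollisions≡ a ⟩
      (∑[ d ← allFin n ] ∑[ d′ ← allFin n ] slice a d d′)
        ≤⟨ ∑-mono (allFin n) (λ d → ∑-mono (allFin n) (slice-split a d)) ⟩
      (∑[ d ← allFin n ] ∑[ d′ ← allFin n ] (degenerate a d d′ + slopeTerms a d d′))
        ≡⟨ ∑∑-+ _ _ ⟩
      (∑[ d ← allFin n ] ∑[ d′ ← allFin n ] degenerate a d d′) + (∑[ d ← allFin n ] ∑[ d′ ← allFin n ] slopeTerms a d d′)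
        ≤⟨ +-monoˡ-≤ _ ∑-degenerate ⟩
      4 * (n * cube n) + (∑[ d ← allFin n ] ∑[ d′ ← allFin n ] slopeTerms a d d′) ∎
      where open ≤-Reasoning

  ∑-slopeTerms : (∑[ a ← allFin n ] ∑[ d ← allFin n ] ∑[ d′ ← allFin n ] slopeTerms a d d′) ≡
                 (∑[ y ← slopes ] incidences y * quadruples y)
  ∑-slopeTerms = begin
    (∑[ a ← allFin n ] ∑[ d ← allFin n ] ∑[ d′ ← allFin n ] ∑[ y ← slopes ] incidence y a d d′ * quadruples y)
      ≡⟨ ∑-cong (allFin n) (λ a → trans (∑-cong (allFin n) (λ d → ∑-swap (allFin n) slopes _)) (∑-swap (allFin n) slopes _)) ⟩
    (∑[ a ← allFin n ] ∑[ y ← slopes ] ∑[ d ← allFin n ] ∑[ d′ ← allFin n ] incidence y a d d′ * quadruples y)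
      ≡⟨ ∑-swap (allFin n) slopes _ ⟩
    (∑[ y ← slopes ] ∑[ a ← allFin n ] ∑[ d ← allFin n ] ∑[ d′ ← allFin n ] incidence y a d d′ * quadruples y)
      ≡⟨ ∑-cong slopes (λ y → trans (∑-cong (allFin n) (λ a → trans (∑-cong (allFin n) (λ d → ∑-*ʳ (allFin n) (quadruples y) _))
           (∑-*ʳ (allFin n) (quadruples y) _))) (∑-*ʳ (allFin n) (quadruples y) _)) ⟩
    (∑[ y ← slopes ] incidences y * quadruples y) ∎
    where open ≡-Reasoning

  module _ (a : Fin n) where

    productSize : ℕ
    productSize = length (values triples (product a))

    atLeast-productSize : AtLeast ℝ productSize A (A a)
    atLeast-productSize = proj₁ ∘ preimage , separated
      where
      vs : List Carrier
      vs = values triples (product a)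
      preimage : ∀ i → ∃ λ t → t ∈ˡ triples × lookup vs i ≡ product a t
      preimage i = ∈-map⁻ (product a) (∈-deduplicate⁻ _≟ᴿ_ (map (product a) triples) (∈-lookup i))
      hits : ∀ i → product a (proj₁ (preimage i)) ≡ lookup vs i
      hits i = sym (proj₂ (proj₂ (preimage i)))
      separated : ∀ i j → product a (proj₁ (preimage i)) ≈ product a (proj₁ (preimage j)) → i ≡ j
      separated i j eq = lookup-separated ≈-sym (values! triples (product a)) i j (≈-cong (hits i) (hits j) eq)
        where
        ≈-cong : ∀ {x x′ y y′} → x ≡ x′ → y ≡ y′ → x ≈ y → x′ ≈ y′
        ≈-cong refl refl eq = eq

    productSize-cauchySchwarz : n * (n * n) * (n * (n * n)) ≤ productSize * productCollisions a
    productSize-cauchySchwarz = subst (λ k → k * k ≤ productSize * productCollisions a) length-triples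
      (collisions≤values*collisions triples (product a))

  -- Averaging over the translates

  module _ .{{_ : NonZero n}} {I : ℕ} (low : cube (2 ^ I) ≤ n) (high : n < 8 * cube (2 ^ I)) where

    ∑-productCollisions≤ : ∑ (allFin n) productCollisions ≤ 184 * (n * n * cube n) * 2 ^ I
    ∑-productCollisions≤ = begin
      ∑ (allFin n) productCollisions
        ≤⟨ ∑-mono (allFin n) productCollisions≤ ⟩
      (∑[ a ← allFin n ] (4 * (n * cube n) + (∑[ d ← allFin n ] ∑[ d′ ← allFin n ] slopeTerms a d d′)))
        ≡⟨ ∑-+ (allFin n) _ _ ⟩
      (∑[ a ← allFin n ] 4 * (n * cube n)) + (∑[ a ← allFin n ] ∑[ d ← allFin n ] ∑[ d′ ← allFin n ] slopeTerms a d d′)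
        ≤⟨ +-mono-≤ (∑-allFin≤ (λ _ → ≤-refl)) (≤-trans (≤-reflexive ∑-slopeTerms)
             (∑-incidences*quadruples≤ slopes! (λ y∈ → proj₂ (∈-filter⁻ admissible? {xs = values triples slope} y∈)) {I} low high)) ⟩
      n * (4 * (n * cube n)) + 180 * (n * n * cube n) * 2 ^ I
        -- The degenerate part lacks the factor `2 ^ I` and is enlarged by it, which gives 4 + 180 =
        -- 184.
        ≤⟨ +-monoˡ-≤ _ (m≤m*n (n * (4 * (n * cube n))) (2 ^ I) {{m^n≢0 2 I}}) ⟩
      n * (4 * (n * cube n)) * 2 ^ I + 180 * (n * n * cube n) * 2 ^ I
        ≡⟨ collect n (cube n) (2 ^ I) ⟩
      184 * (n * n * cube n) * 2 ^ I ∎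
      where
      open ≤-Reasoning
      collect : ∀ n N X → n * (4 * (n * N)) * X + 180 * (n * n * N) * X ≡ 184 * (n * n * N) * X
      collect = solve-∀

    popularTranslates : ∀ K .{{_ : NonZero K}} → 2 * ∑ (allFin n) productCollisions ≤ n * (K * (n * cube n) * 2 ^ I) →
      ∀ {L} → 1 ≤ L →
      Σ (Subset n) λ A' → (n ≤ 2 * ∣ A' ∣) ×
      (∀ i → i ∈ A' → Σ ℕ λ m → AtLeast ℝ m A (A i) × (n ^ 5 ≤ cube K * (m ^ 3 * L)))
    popularTranslates K average 1≤L =
      subset few? , markov productCollisions T average ,
      λ a a∈ → productSize a , atLeast-productSize a ,
        fifth-power-bound {n} {productSize a} K (2 ^ I) low
          (size-bound {n} {productSize a} {productCollisions a} K (2 ^ I) (productSize-cauchySchwarz a) (∈-subset⁻ few? a∈)) 1≤L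
      where
      T : ℕ
      -- By `average`, this threshold is at least twice the mean number of collisions; the factor 2
      -- in `2 * 184` is chosen for this.
      T = K * (n * cube n) * 2 ^ I
      few? : ∀ a → Dec (productCollisions a ≤ T)
      few? a = productCollisions a ≤? T
      instance
        X≢0 : NonZero (2 ^ I)
        X≢0 = m^n≢0 2 I
        n²≢0 : NonZero (n * n)
        n²≢0 = m*n≢0 n n
        n³≢0 : NonZero (cube n)
        n³≢0 = m*n≢0 (n * n) n
        n⁴≢0 : NonZero (n * cube n)
        n⁴≢0 = m*n≢0 n (cube n)
        Kn⁴≢0 : NonZero (K * (n * cube n))
        Kn⁴≢0 = m*n≢0 K (n * cube n)
        T≢0 : NonZero T
        T≢0 = m*n≢0 (K * (n * cube n)) (2 ^ I)

-- K is a variable so that multiples of the constant cube 368 are never unfolded in unary.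
boundWithConstant : ∀ K .{{_ : NonZero K}} → 2 * 184 ≡ K → Σ ℕ λ C →
    (ℝ : RealNumbers) → (n : ℕ) → 2 ≤ n →
    (A : Fin n → RealNumbers.Carrier ℝ) → IsFiniteSet ℝ n A →
    Σ (Subset n) λ A' → (n ≤ 2 * ∣ A' ∣) ×
    (∀ i → i ∈ A' →
    Σ ℕ λ m → AtLeast ℝ m A (A i) × (n ^ 5 ≤ C * (m ^ 3 * ⌊log₂ n ⌋)))
boundWithConstant K 2*184≡K = cube K , bound
  where
  bound : (ℝ : RealNumbers) (n : ℕ) → 2 ≤ n → (A : Fin n → RealNumbers.Carrier ℝ) → IsFiniteSet ℝ n A →
          Σ (Subset n) λ A' → (n ≤ 2 * ∣ A' ∣) ×
          (∀ i → i ∈ A' → Σ ℕ λ m → AtLeast ℝ m A (A i) × (n ^ 5 ≤ cube K * (m ^ 3 * ⌊log₂ n ⌋)))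
  bound ℝ n 2≤n A A-injective with ⌊cubeRoot⌋₂ n (≤-trans (s≤s z≤n) 2≤n)
  ... | I , low , high = popularTranslates {{n≢0}} {I} low high K average (⌊log₂⌋-mono-≤ 2≤n)
    where
    open Products ℝ n A A-injective
    open ≤-Reasoning
    n≢0 : NonZero n
    n≢0 = >-nonZero (≤-trans (s≤s z≤n) 2≤n)
    regroup : ∀ k n N X → 2 * (k * (n * n * N) * X) ≡ n * (2 * k * (n * N) * X)
    regroup = solve-∀
    average : 2 * ∑ (allFin n) productCollisions ≤ n * (K * (n * cube n) * 2 ^ I)
    average = begin
      2 * ∑ (allFin n) productCollisions       ≤⟨ *-monoʳ-≤ 2 (∑-productCollisions≤ {{n≢0}} {I} low high) ⟩
      2 * (184 * (n * n * cube n) * 2 ^ I)     ≡⟨ regroup 184 n (cube n) (2 ^ I) ⟩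
      n * (2 * 184 * (n * cube n) * 2 ^ I)     ≡⟨ cong (λ k → n * (k * (n * cube n) * 2 ^ I)) 2*184≡K ⟩
      n * (K * (n * cube n) * 2 ^ I)           ∎

theorem2p10 : Σ ℕ λ C →
    (ℝ : RealNumbers) → (n : ℕ) → 2 ≤ n →
    (A : Fin n → RealNumbers.Carrier ℝ) → IsFiniteSet ℝ n A →
    Σ (Subset n) λ A' → (n ≤ 2 * ∣ A' ∣) ×
    (∀ i → i ∈ A' →
    Σ ℕ λ m → AtLeast ℝ m A (A i) × (n ^ 5 ≤ C * (m ^ 3 * ⌊log₂ n ⌋)))
theorem2p10 = boundWithConstant 368 refl
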